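{- Let $q,z\in\mathbb{C}$ with $|q|<1$ and $z\neq 0$. Then the sequences $$\alpha_n=z^{n}q^{\binom{n+1}{2}}\quad(n\in\mathbb{Z}),\qquad \beta_n=\frac{(-1/z)_{n+1}(-zq)_n}{(q)_{2n+1}}\quad(n\ge 0)$$ form an asymmetric bilateral Bailey pair with $a=1$ and $\lambda=1$; that is, for every integer $n\ge 0$, $$\beta_n=\sum_{k=-n-1}^{n}\frac{\alpha_k}{(q)_{n-k}(q)_{n+k+1}}.$$
   Context: For $n\ge 0$, $(a)_n=(a;q)_n=\prod_{j=1}^{n}(1-aq^{j-1})$, with $(a)_0=1$. For $m\in\mathbb{Z}$, $\binom{m}{2}=m(m-1)/2$. A pair of sequences $(\alpha_n)_{n\in\mathbb{Z}}$, $(\beta_n)_{n\ge 0}$ is an asymmetric bilateral Bailey pair with $a=1$, $\lambda=1$ if $\beta_n=\sum_{k=-n-1}^{n}\alpha_k/\big((q)_{n-k}(q)_{n+k+1}\big)$ for all $n\ge 0$. -}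

module Defs where

open import Algebra.Bundles using (CommutativeRing)
open import Data.Fin.Base using (toℕ)
open import Data.Integer.Base as ℤ using (ℤ; +_; -[1+_]; 0ℤ; 1ℤ)
import Data.Integer.DivMod as ℤ using (_/_)
import Data.Integer.Properties as ℤ
open import Data.Nat.Base as ℕ using (ℕ; zero; suc)
import Data.Nat.Coprimality as ℕ using (1-coprimeTo) renaming (sym to coprime-sym)
import Data.Nat.Properties as ℕ
open import Data.Product.Base using (∃-syntax; _×_; _,_)
open import Data.Rational.Base as ℚ using (ℚ; mkℚ; 0ℚ; 1ℚ; ½; toℚᵘ)
import Data.Rational.Properties as ℚ
open import Data.Rational.Solver using (module +-*-Solver)
import Data.Rational.Unnormalised.Base as ℚᵘ
import Data.Rational.Unnormalised.Properties as ℚᵘ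
open import Data.Sum.Base using (inj₁; inj₂)
open import Level using (0ℓ)
open import Relation.Binary.PropositionalEquality
  using (_≡_; refl; sym; trans; cong; cong₂; subst; subst₂)
open import Relation.Binary.Structures using (IsEquivalence)
open import Relation.Nullary using (yes; no; contradiction)

module Order where
  open import Data.Rational.Base using (_+_; _-_; _*_; -_; _≤_; _<_; ∣_∣)
  open +-*-Solver

  ≤⇒0≤ : ∀ {p q} → p ≤ q → 0ℚ ≤ q - p
  ≤⇒0≤ {p} {q} h = subst (_≤ q - p) (ℚ.+-inverseʳ p) (ℚ.+-monoˡ-≤ (- p) h)

  <⇒0< : ∀ {p q} → p < q → 0ℚ < q - p
  <⇒0< {p} {q} h = subst (_< q - p) (ℚ.+-inverseʳ p) (ℚ.+-monoˡ-< (- p) h)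

  cancel : ∀ p q → (q - p) + p ≡ q
  cancel = solve 2 (λ p q → (q :- p) :+ p := q) refl

  0≤⇒≤ : ∀ {p q} → 0ℚ ≤ q - p → p ≤ q
  0≤⇒≤ {p} {q} h = subst₂ _≤_ (ℚ.+-identityˡ p) (cancel p q) (ℚ.+-monoˡ-≤ p h)

  0<⇒< : ∀ {p q} → 0ℚ < q - p → p < q
  0<⇒< {p} {q} h = subst₂ _<_ (ℚ.+-identityˡ p) (cancel p q) (ℚ.+-monoˡ-< p h)

  -- p ≤ q follows once q - p is rewritten as a manifestly nonnegative r.
  ≤-by : ∀ {p q} r → q - p ≡ r → 0ℚ ≤ r → p ≤ q
  ≤-by r eq h = 0≤⇒≤ (subst (0ℚ ≤_) (sym eq) h)

  <-by : ∀ {p q} r → q - p ≡ r → 0ℚ < r → p < q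
  <-by r eq h = 0<⇒< (subst (0ℚ <_) (sym eq) h)

  0≤+ : ∀ {p q} → 0ℚ ≤ p → 0ℚ ≤ q → 0ℚ ≤ p + q
  0≤+ {p} {q} h k = subst (_≤ p + q) (ℚ.+-identityˡ 0ℚ) (ℚ.+-mono-≤ h k)

  0<+ : ∀ {p q} → 0ℚ < p → 0ℚ ≤ q → 0ℚ < p + q
  0<+ {p} {q} h k = subst (_< p + q) (ℚ.+-identityˡ 0ℚ) (ℚ.+-mono-<-≤ h k)

  0≤* : ∀ {p q} → 0ℚ ≤ p → 0ℚ ≤ q → 0ℚ ≤ p * q
  0≤* {p} {q} h k = ℚ.nonNegative⁻¹ (p * q)
    {{ℚ.nonNeg*nonNeg⇒nonNeg p {{ℚ.nonNegative h}} q {{ℚ.nonNegative k}}}}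

  0<* : ∀ {p q} → 0ℚ < p → 0ℚ < q → 0ℚ < p * q
  0<* {p} {q} h k = ℚ.positive⁻¹ (p * q)
    {{ℚ.pos*pos⇒pos p {{ℚ.positive h}} q {{ℚ.positive k}}}}

  0<½ : 0ℚ < ½
  0<½ = ℚ.positive⁻¹ ½

  0<1 : 0ℚ < 1ℚ
  0<1 = ℚ.positive⁻¹ 1ℚ

  0<half : ∀ {p} → 0ℚ < p → 0ℚ < ½ * p
  0<half = 0<* 0<½

  0≤² : ∀ p → 0ℚ ≤ p * p
  0≤² p with ℚ.≤-total 0ℚ p
  ... | inj₁ 0≤p = 0≤* 0≤p 0≤p
  ... | inj₂ p≤0 = subst (0ℚ ≤_)
    (solve 1 (λ p → (con 0ℚ :- p) :* (con 0ℚ :- p) := p :* p) refl p)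
    (0≤* (≤⇒0≤ p≤0) (≤⇒0≤ p≤0))

  ≤∣∣ : ∀ p → p ≤ ∣ p ∣
  ≤∣∣ p with ℚ.≤-total 0ℚ p
  ... | inj₁ 0≤p = ℚ.≤-reflexive (sym (ℚ.0≤p⇒∣p∣≡p 0≤p))
  ... | inj₂ p≤0 = ℚ.≤-trans p≤0 (ℚ.0≤∣p∣ p)

  ∣∣<⇒< : ∀ {p ε} → ∣ p ∣ < ε → p < ε
  ∣∣<⇒< {p} h = ℚ.≤-<-trans (≤∣∣ p) h

  ∣∣-swap : ∀ p q → ∣ p - q ∣ ≡ ∣ q - p ∣
  ∣∣-swap p q = trans (sym (ℚ.∣-p∣≡∣p∣ (p - q)))
    (cong ∣_∣ (solve 2 (λ p q → :- (p :- q) := q :- p) refl p q))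

  ∣∣<-by : ∀ {p ε} → p < ε → - p < ε → ∣ p ∣ < ε
  ∣∣<-by {p} {ε} h k with ℚ.∣p∣≡p∨∣p∣≡-p p
  ... | inj₁ eq = subst (_< ε) (sym eq) h
  ... | inj₂ eq = subst (_< ε) (sym eq) k

  ½+½ : ∀ p → ½ * p + ½ * p ≡ p
  ½+½ = solve 1 (λ p → con ½ :* p :+ con ½ :* p := p) refl

  -- a + b < ε from |a| , |b| < ε / 2
  ∣+∣< : ∀ {p q ε} → ∣ p ∣ < ½ * ε → ∣ q ∣ < ½ * ε → ∣ p + q ∣ < ε
  ∣+∣< {p} {q} {ε} h k = ℚ.≤-<-trans (ℚ.∣p+q∣≤∣p∣+∣q∣ p q)
    (subst (∣ p ∣ + ∣ q ∣ <_) (½+½ ε) (ℚ.+-mono-< h k))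

  ∣*∣≤ : ∀ {p q A B} → ∣ p ∣ ≤ A → ∣ q ∣ ≤ B → ∣ p * q ∣ ≤ A * B
  ∣*∣≤ {p} {q} {A} {B} h k = subst (_≤ A * B) (sym (ℚ.∣p*q∣≡∣p∣*∣q∣ p q))
    (≤-by ((A - ∣ p ∣) * B + ∣ p ∣ * (B - ∣ q ∣))
      (solve 4 (λ P Q A B → A :* B :- P :* Q := (A :- P) :* B :+ P :* (B :- Q))
        refl (∣ p ∣) (∣ q ∣) A B)
      (0≤+ (0≤* (≤⇒0≤ h) (ℚ.≤-trans (ℚ.0≤∣p∣ q) k))
           (0≤* (ℚ.0≤∣p∣ p) (≤⇒0≤ k))))

  -- |ab - cd| < ε for |a| ≤ A, |d| ≤ D and |a - c|, |b - d| < δ, (A + D) δ = ε.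
  mul-est : ∀ {a b c d A D δ ε} → 0ℚ < A → 0ℚ < D → ∣ a ∣ ≤ A → ∣ d ∣ ≤ D →
            ∣ a - c ∣ < δ → ∣ b - d ∣ < δ → (A + D) * δ ≡ ε →
            ∣ a * b - c * d ∣ < ε
  mul-est {a} {b} {c} {d} {A} {D} {δ} {ε} A>0 D>0 ∣a∣ ∣d∣ ac bd eq =
    ℚ.≤-<-trans
      (subst (λ t → ∣ t ∣ ≤ A * ∣ b - d ∣ + ∣ a - c ∣ * D)
        (solve 4 (λ a b c d → a :* (b :- d) :+ (a :- c) :* d := a :* b :- c :* d)
          refl a b c d)
        (ℚ.≤-trans (ℚ.∣p+q∣≤∣p∣+∣q∣ (a * (b - d)) ((a - c) * d))
          (ℚ.+-mono-≤ (∣*∣≤ {a} {b - d} ∣a∣ ℚ.≤-refl)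
                      (∣*∣≤ {a - c} {d} ℚ.≤-refl ∣d∣))))
      (<-by (A * (δ - ∣ b - d ∣) + D * (δ - ∣ a - c ∣))
        (trans (cong (_- (A * ∣ b - d ∣ + ∣ a - c ∣ * D)) (sym eq))
          (solve 5 (λ A D δ x y → (A :+ D) :* δ :- (A :* x :+ y :* D)
              := A :* (δ :- x) :+ D :* (δ :- y)) refl A D δ (∣ b - d ∣) (∣ a - c ∣)))
        (0<+ (0<* A>0 (<⇒0< bd)) (ℚ.<⇒≤ (0<* D>0 (<⇒0< ac)))))

  divide : ∀ {B ε} → 0ℚ < B → 0ℚ < ε → ∃[ δ ] 0ℚ < δ × B * δ ≡ ε
  divide {B} {ε} B>0 ε>0 = r * ε , 0<* r>0 ε>0 ,
    trans (sym (ℚ.*-assoc B r ε))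
      (trans (cong (_* ε) (ℚ.*-inverseʳ B)) (ℚ.*-identityˡ ε))
    where
    instance
      B-pos : ℚ.Positive B
      B-pos = ℚ.positive B>0
      B-nonZero : ℚ.NonZero B
      B-nonZero = ℚ.pos⇒nonZero B
    r = ℚ.1/ B
    r>0 : 0ℚ < r
    r>0 = ℚ.positive⁻¹ r {{ℚ.1/pos⇒pos B}}

  ²-mono-≤ : ∀ {p q} → 0ℚ ≤ p → p ≤ q → p * p ≤ q * q
  ²-mono-≤ {p} {q} 0≤p h = ≤-by ((q - p) * (q + p))
    (solve 2 (λ p q → q :* q :- p :* p := (q :- p) :* (q :+ p)) refl p q)
    (0≤* (≤⇒0≤ h) (0≤+ (ℚ.≤-trans 0≤p h) 0≤p))

open Order

------------------------------------------------------------------------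
-- The real numbers: Cauchy sequences of rationals up to null sequences.

Eventually : (ℕ → Set) → Set
Eventually P = ∃[ N ] ∀ n → N ℕ.≤ n → P n

always : ∀ {P : ℕ → Set} → (∀ n → P n) → Eventually P
always h = 0 , λ n _ → h n

eventually-map : ∀ {P Q : ℕ → Set} → (∀ n → P n → Q n) → Eventually P → Eventually Q
eventually-map f (N , h) = N , λ n N≤n → f n (h n N≤n)

eventually-zip : ∀ {P Q R : ℕ → Set} → (∀ n → P n → Q n → R n) →
                 Eventually P → Eventually Q → Eventually R
eventually-zip f (M , h) (N , k) = M ℕ.⊔ N , λ n le →
  f n (h n (ℕ.≤-trans (ℕ.m≤m⊔n M N) le)) (k n (ℕ.≤-trans (ℕ.m≤n⊔m M N) le))

Cauchy : (ℕ → ℚ) → Set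
Cauchy x = ∀ ε → 0ℚ ℚ.< ε →
  ∃[ N ] ∀ m n → N ℕ.≤ m → N ℕ.≤ n → ℚ.∣ x m ℚ.- x n ∣ ℚ.< ε

-- Without η, and with the operations below given by copatterns, sums and products of
-- reals (and of complex numbers) stay folded during unification.
record ℝ : Set where
  no-eta-equality
  field
    seq    : ℕ → ℚ
    cauchy : Cauchy seq

open ℝ public

infix 4 _≈ℝ_ _<ℝ_

record _≈ℝ_ (x y : ℝ) : Set where
  constructor mk≈ℝ
  field
    close : ∀ ε → 0ℚ ℚ.< ε → Eventually (λ n → ℚ.∣ seq x n ℚ.- seq y n ∣ ℚ.< ε)

open _≈ℝ_ public

record _<ℝ_ (x y : ℝ) : Set where
  constructor mk<ℝ
  field
    gap        : ℚ
    gap>0      : 0ℚ ℚ.< gap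
    separation : Eventually (λ n → seq x n ℚ.+ gap ℚ.≤ seq y n)

open _<ℝ_ public

module Real where
  open import Data.Rational.Base using (_+_; _-_; _*_; -_; _≤_; _<_; ∣_∣)
  open +-*-Solver

  zip-indices : ∀ {P Q R : ℕ → ℕ → Set} → (∀ m n → P m n → Q m n → R m n) →
    (∃[ N ] ∀ m n → N ℕ.≤ m → N ℕ.≤ n → P m n) →
    (∃[ N ] ∀ m n → N ℕ.≤ m → N ℕ.≤ n → Q m n) →
    ∃[ N ] ∀ m n → N ℕ.≤ m → N ℕ.≤ n → R m n
  zip-indices f (M , h) (N , k) = M ℕ.⊔ N , λ m n p q →
    f m n (h m n (ℕ.≤-trans (ℕ.m≤m⊔n M N) p) (ℕ.≤-trans (ℕ.m≤m⊔n M N) q))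
          (k m n (ℕ.≤-trans (ℕ.m≤n⊔m M N) p) (ℕ.≤-trans (ℕ.m≤n⊔m M N) q))

  both : ∀ {P : ℕ → Set} → Eventually P →
         ∃[ N ] ∀ m n → N ℕ.≤ m → N ℕ.≤ n → P m × P n
  both (N , h) = N , λ m n p q → h m p , h n q

  bounded : ∀ x → Cauchy x → ∃[ B ] 0ℚ < B × Eventually (λ n → ∣ x n ∣ ≤ B)
  bounded x cx with cx 1ℚ 0<1
  ... | N , h = 1ℚ + ∣ x N ∣ , 0<+ 0<1 (ℚ.0≤∣p∣ (x N)) , N , λ n N≤n →
    subst (λ t → ∣ t ∣ ≤ 1ℚ + ∣ x N ∣) (cancel (x N) (x n))
      (ℚ.≤-trans (ℚ.∣p+q∣≤∣p∣+∣q∣ (x n - x N) (x N))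
        (ℚ.+-monoˡ-≤ (∣ x N ∣) (ℚ.<⇒≤ (h n N N≤n ℕ.≤-refl))))

  const-cauchy : ∀ p → Cauchy (λ _ → p)
  const-cauchy p ε ε>0 = 0 , λ _ _ _ _ →
    subst (λ t → ∣ t ∣ < ε) (sym (ℚ.+-inverseʳ p)) ε>0

  +-split : ∀ a b c d → (a - c) + (b - d) ≡ (a + b) - (c + d)
  +-split = solve 4 (λ a b c d → (a :- c) :+ (b :- d) := (a :+ b) :- (c :+ d)) refl

  neg-split : ∀ a b → b - a ≡ (- a) - (- b)
  neg-split = solve 2 (λ a b → b :- a := (:- a) :- (:- b)) refl

  +-cauchy : ∀ x y → Cauchy x → Cauchy y → Cauchy (λ n → x n + y n)
  +-cauchy x y cx cy ε ε>0 = zip-indices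
    (λ m n h k → subst (λ t → ∣ t ∣ < ε) (+-split (x m) (y m) (x n) (y n))
      (∣+∣< {x m - x n} {y m - y n} h k))
    (cx (½ * ε) (0<half ε>0)) (cy (½ * ε) (0<half ε>0))

  neg-cauchy : ∀ x → Cauchy x → Cauchy (λ n → - x n)
  neg-cauchy x cx ε ε>0 with cx ε ε>0
  ... | N , h = N , λ m n p q →
    subst (λ t → ∣ t ∣ < ε) (neg-split (x m) (x n)) (h n m q p)

  *-cauchy : ∀ x y → Cauchy x → Cauchy y → Cauchy (λ n → x n * y n)
  *-cauchy x y cx cy ε ε>0 =
    let A , A>0 , ∣x∣≤A = bounded x cx
        D , D>0 , ∣y∣≤D = bounded y cy
        δ , δ>0 , eq    = divide (0<+ A>0 (ℚ.<⇒≤ D>0)) ε>0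
    in zip-indices
      (λ m n (a , d) (h , k) → mul-est {x m} {y m} {x n} {y n} A>0 D>0 a d h k eq)
      (zip-indices (λ _ _ (a , _) (_ , d) → a , d) (both ∣x∣≤A) (both ∣y∣≤D))
      (zip-indices (λ _ _ → _,_) (cx δ δ>0) (cy δ δ>0))

  -- The value at 0 is irrelevant: only sequences bounded away from 0 are inverted.
  recipℚ : ℚ → ℚ
  recipℚ p with p ℚ.≟ 0ℚ
  ... | yes _  = 0ℚ
  ... | no p≢0 = (ℚ.1/ p) {{ℚ.≢-nonZero p≢0}}

  recipℚ-inverse : ∀ {p} → 0ℚ < p → p * recipℚ p ≡ 1ℚ
  recipℚ-inverse {p} 0<p with p ℚ.≟ 0ℚ
  ... | yes p≡0 = contradiction (sym p≡0) (ℚ.<⇒≢ 0<p)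
  ... | no p≢0  = ℚ.*-inverseʳ p {{ℚ.≢-nonZero p≢0}}

  recip-est : ∀ {a b δ ε} → 0ℚ < δ → δ ≤ a → δ ≤ b → 0ℚ < ε →
              b - a < (δ * δ) * ε → recipℚ a - recipℚ b < ε
  recip-est {a} {b} {δ} {ε} δ>0 δ≤a δ≤b ε>0 h =
    ℚ.*-cancelˡ-<-nonNeg (a * b) {{ℚ.nonNegative (0≤* 0≤a 0≤b)}}
      (subst (_< a * b * ε) (sym lhs)
        (ℚ.<-≤-trans h (ℚ.*-monoʳ-≤-nonNeg ε {{ℚ.nonNegative (ℚ.<⇒≤ ε>0)}} δδ≤ab)))
    where
    a>0 = ℚ.<-≤-trans δ>0 δ≤a
    b>0 = ℚ.<-≤-trans δ>0 δ≤b
    0≤a = ℚ.<⇒≤ a>0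
    0≤b = ℚ.<⇒≤ b>0
    δδ≤ab : δ * δ ≤ a * b
    δδ≤ab = ≤-by ((a - δ) * b + δ * (b - δ))
      (solve 3 (λ a b δ → a :* b :- δ :* δ := (a :- δ) :* b :+ δ :* (b :- δ)) refl a b δ)
      (0≤+ (0≤* (≤⇒0≤ δ≤a) 0≤b) (0≤* (ℚ.<⇒≤ δ>0) (≤⇒0≤ δ≤b)))
    lhs : a * b * (recipℚ a - recipℚ b) ≡ b - a
    lhs = trans
      (solve 4 (λ a b r s → a :* b :* (r :- s) := b :* (a :* r) :- a :* (b :* s))
        refl a b (recipℚ a) (recipℚ b))
      (cong₂ _-_
        (trans (cong (b *_) (recipℚ-inverse a>0)) (ℚ.*-identityʳ b))
        (trans (cong (a *_) (recipℚ-inverse b>0)) (ℚ.*-identityʳ a)))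

  recip-cauchy : ∀ x {δ} → 0ℚ < δ → Eventually (λ n → δ ≤ x n) → Cauchy x →
                 Cauchy (λ n → recipℚ (x n))
  recip-cauchy x {δ} δ>0 away cx ε ε>0 = zip-indices
    (λ m n (δ≤m , δ≤n) h → ∣∣<-by
      (recip-est δ>0 δ≤m δ≤n ε>0
        (∣∣<⇒< (subst (_< (δ * δ) * ε) (∣∣-swap (x m) (x n)) h)))
      (subst (_< ε)
        (solve 2 (λ r s → s :- r := :- (r :- s)) refl (recipℚ (x m)) (recipℚ (x n)))
        (recip-est δ>0 δ≤n δ≤m ε>0 (∣∣<⇒< h))))
    (both away) (cx ((δ * δ) * ε) (0<* (0<* δ>0 δ>0) ε>0))

  -- Powers of ½ tend to 0.

  ι : ℕ → ℚ
  ι n = mkℚ (+ n) 0 (ℕ.coprime-sym (ℕ.1-coprimeTo n))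

  ι-suc : ∀ n → ι (suc n) ≡ ι n + 1ℚ
  ι-suc n = ℚ.toℚᵘ-injective (ℚᵘ.≃-trans
    (ℚᵘ.*≡* (cong (ℤ._* 1ℤ) (trans (ℤ.+-comm 1ℤ (+ n))
      (cong (ℤ._+ 1ℤ) (sym (ℤ.*-identityʳ (+ n)))))))
    (ℚᵘ.≃-sym (ℚ.toℚᵘ-homo-+ (ι n) 1ℚ)))

  1≤ι-suc : ∀ n → 1ℚ ≤ ι (suc n)
  1≤ι-suc zero    = ℚ.≤-refl
  1≤ι-suc (suc n) = subst (1ℚ ≤_) (sym (ι-suc (suc n)))
    (ℚ.≤-trans (1≤ι-suc n) (≤-by 1ℚ
      (solve 1 (λ p → p :+ con 1ℚ :- p := con 1ℚ) refl (ι (suc n))) (ℚ.<⇒≤ 0<1)))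

  ι-mono : ∀ {m n} → m ℕ.≤ n → ι m ≤ ι n
  ι-mono {m} {n} m≤n = ℚ.*≤* (subst₂ ℤ._≤_
    (sym (ℤ.*-identityʳ (+ m))) (sym (ℤ.*-identityʳ (+ n))) (ℤ.+≤+ m≤n))

  archimedean : ∀ {ε} → 0ℚ < ε → ∃[ N ] 1ℚ ≤ ε * ι N
  archimedean {mkℚ (+ 0) d _} (ℚ.*<* (ℤ.+<+ ()))
  archimedean {mkℚ -[1+ _ ] d _} (ℚ.*<* ())
  archimedean {ε@(mkℚ (+ suc p) d _)} _ = suc d , ℚ.toℚᵘ-cancel-≤
    (ℚᵘ.≤-respʳ-≃ (ℚᵘ.≃-sym (ℚ.toℚᵘ-homo-* ε (ι (suc d))))
      (ℚᵘ.*≤* (ℤ.+≤+ (ℕ.≤-trans (ℕ.≤-reflexive lhs) rhs))))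
    where
    lhs : 1 ℕ.* suc (d ℕ.* 1) ≡ suc d
    lhs = trans (ℕ.*-identityˡ _) (cong suc (ℕ.*-identityʳ d))
    rhs : suc d ℕ.≤ suc p ℕ.* suc d ℕ.* 1
    rhs = ℕ.≤-trans (ℕ.m≤m+n (suc d) (p ℕ.* suc d))
      (ℕ.≤-reflexive (sym (ℕ.*-identityʳ _)))

  ½^ : ℕ → ℚ
  ½^ zero    = 1ℚ
  ½^ (suc n) = ½ * ½^ n

  ½^>0 : ∀ n → 0ℚ < ½^ n
  ½^>0 zero    = 0<1
  ½^>0 (suc n) = 0<half (½^>0 n)

  ½^-bound : ∀ n → ½^ n * ι (suc n) ≤ 1ℚ
  ½^-bound zero    = ℚ.≤-refl
  ½^-bound (suc n) = ℚ.≤-trans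
    (subst (λ t → ½ * ½^ n * t ≤ ½^ n * ι (suc n)) (sym (ι-suc (suc n)))
      (≤-by (½ * ½^ n * (ι (suc n) - 1ℚ))
        (solve 2 (λ h i → h :* i :- con ½ :* h :* (i :+ con 1ℚ)
          := con ½ :* h :* (i :- con 1ℚ)) refl (½^ n) (ι (suc n)))
        (0≤* (ℚ.<⇒≤ (½^>0 (suc n))) (≤⇒0≤ (1≤ι-suc n)))))
    (½^-bound n)

  ½^→0 : ∀ ε → 0ℚ < ε → Eventually (λ n → ½^ n < ε)
  ½^→0 ε ε>0 with archimedean ε>0
  ... | N , h = N , λ n N≤n →
    ℚ.*-cancelʳ-<-nonNeg (ι (suc n)) {{_}}
      (ℚ.≤-<-trans (½^-bound n) (ℚ.≤-<-trans h
        (<-by (ε * (ι n - ι N) + ε)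
          (trans (cong (λ t → ε * t - ε * ι N) (ι-suc n))
            (solve 3 (λ ε i j → ε :* (i :+ con 1ℚ) :- ε :* j := ε :* (i :- j) :+ ε)
              refl ε (ι n) (ι N)))
          (subst (0ℚ <_) (ℚ.+-comm ε _)
            (0<+ ε>0 (0≤* (ℚ.<⇒≤ ε>0) (≤⇒0≤ (ι-mono N≤n))))))))

  -- Square roots by bisection: y² ≤ c < (y + w)² with w halved at each step.

  bisect : ℚ → ℚ → ℚ → ℚ
  bisect c y w with (y + w) * (y + w) ℚ.≤? c
  ... | yes _ = y + w
  ... | no  _ = y

  width : ℚ → ℕ → ℚ
  width c n = (1ℚ + c) * ½^ n

  sqrtℚ : ℚ → ℕ → ℚ
  sqrtℚ c zero    = 0ℚ
  sqrtℚ c (suc n) = bisect c (sqrtℚ c n) (width c (suc n))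

  record Brackets (c y w : ℚ) : Set where
    constructor brackets
    field
      nonneg : 0ℚ ≤ y
      lower  : y * y ≤ c
      upper  : c < (y + w) * (y + w)

  open Brackets public

  bisect-brackets : ∀ {c y w} → 0ℚ ≤ w → Brackets c y (w + w) → Brackets c (bisect c y w) w
  bisect-brackets {c} {y} {w} 0≤w (brackets n l u) with (y + w) * (y + w) ℚ.≤? c
  ... | yes h = brackets (0≤+ n 0≤w) h
    (subst (λ t → c < t * t) (sym (ℚ.+-assoc y w w)) u)
  ... | no ¬h = brackets n l (ℚ.≰⇒> ¬h)

  sqrtℚ-brackets : ∀ {c} → 0ℚ ≤ c → ∀ n → Brackets c (sqrtℚ c n) (width c n)
  sqrtℚ-brackets {c} 0≤c zero = brackets ℚ.≤-refl 0≤c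
    (<-by (1ℚ + (c + c * c))
      (solve 1 (λ c → (con 0ℚ :+ (con 1ℚ :+ c) :* con 1ℚ) :* (con 0ℚ :+ (con 1ℚ :+ c) :* con 1ℚ) :- c
         := con 1ℚ :+ (c :+ c :* c)) refl c)
      (0<+ 0<1 (0≤+ 0≤c (0≤² c))))
  sqrtℚ-brackets {c} 0≤c (suc n) = bisect-brackets
    (0≤* (0≤+ (ℚ.<⇒≤ 0<1) 0≤c) (ℚ.<⇒≤ (½^>0 (suc n))))
    (subst (Brackets c (sqrtℚ c n))
      (solve 2 (λ c h → (con 1ℚ :+ c) :* h
        := (con 1ℚ :+ c) :* (con ½ :* h) :+ (con 1ℚ :+ c) :* (con ½ :* h)) refl c (½^ n))
      (sqrtℚ-brackets 0≤c n))

  module Sqrt (x : ℕ → ℚ) (cx : Cauchy x) (0≤x : ∀ n → 0ℚ ≤ x n) where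

    s w : ℕ → ℚ
    s n = sqrtℚ (x n) n
    w n = width (x n) n

    s-brackets : ∀ n → Brackets (x n) (s n) (w n)
    s-brackets n = sqrtℚ-brackets (0≤x n) n

    w→0 : ∀ ε → 0ℚ < ε → Eventually (λ n → w n < ε)
    w→0 ε ε>0 =
      let B , B>0 , ∣x∣≤B = bounded x cx
          0<1+B           = 0<+ 0<1 (ℚ.<⇒≤ B>0)
          δ , δ>0 , eq    = divide 0<1+B ε>0
      in eventually-zip
        (λ n b h → <-by ((1ℚ + B) * (δ - ½^ n) + (B - x n) * ½^ n)
          (trans (cong (_- w n) (sym eq))
            (solve 4 (λ B δ c h → (con 1ℚ :+ B) :* δ :- (con 1ℚ :+ c) :* h
               := (con 1ℚ :+ B) :* (δ :- h) :+ (B :- c) :* h) refl B δ (x n) (½^ n)))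
          (0<+ (0<* 0<1+B (<⇒0< h))
            (0≤* (≤⇒0≤ (ℚ.≤-trans (≤∣∣ (x n)) b)) (ℚ.<⇒≤ (½^>0 n)))))
        ∣x∣≤B (½^→0 δ δ>0)

    s-close : ∀ {ε} m n → 0ℚ < ε → w n < ½ * ε → ∣ x m - x n ∣ < ½ * (ε * ε) →
              s m < s n + ε
    s-close {ε} m n ε>0 w< h = ℚ.≰⇒> λ le →
      let open Brackets (s-brackets n) using () renaming (nonneg to 0≤s; upper to u)
          0≤ε = ℚ.<⇒≤ ε>0
          0≤½ε = ℚ.<⇒≤ (0<half ε>0)
          y = s n
          -- (y + ε)² ≤ x m < x n + ε²/2 < (y + ε/2)² + ε²/2
          one : (y + ε) * (y + ε) ≤ x m
          one = ℚ.≤-trans (²-mono-≤ (0≤+ 0≤s 0≤ε) le) (lower (s-brackets m))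
          two : x m < (y + ½ * ε) * (y + ½ * ε) + ½ * (ε * ε)
          two = subst (_< (y + ½ * ε) * (y + ½ * ε) + ½ * (ε * ε))
            (solve 2 (λ a b → b :+ (a :- b) := a) refl (x m) (x n))
            (ℚ.+-mono-≤-< (ℚ.≤-trans (ℚ.<⇒≤ u) (²-mono-≤
                (0≤+ 0≤s (0≤* (0≤+ (ℚ.<⇒≤ 0<1) (0≤x n)) (ℚ.<⇒≤ (½^>0 n))))
                (ℚ.+-monoʳ-≤ y (ℚ.<⇒≤ w<))))
              (∣∣<⇒< h))
          three : (y + ½ * ε) * (y + ½ * ε) + ½ * (ε * ε) ≤ (y + ε) * (y + ε)
          three = ≤-by (y * ε + (½ * ε) * (½ * ε))
            (solve 2 (λ y ε → (y :+ ε) :* (y :+ ε) :-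
                ((y :+ con ½ :* ε) :* (y :+ con ½ :* ε) :+ con ½ :* (ε :* ε))
                := y :* ε :+ (con ½ :* ε) :* (con ½ :* ε)) refl y ε)
            (0≤+ (0≤* 0≤s 0≤ε) (0≤* 0≤½ε 0≤½ε))
      in ℚ.<-irrefl refl (ℚ.<-≤-trans two (ℚ.≤-trans three one))

    s-cauchy : Cauchy s
    s-cauchy ε ε>0 = zip-indices
      (λ m n (wm , wn) h → ∣∣<-by
        (<-by (s n + ε - s m)
          (solve 3 (λ a b ε → ε :- (a :- b) := b :+ ε :- a) refl (s m) (s n) ε)
          (<⇒0< (s-close m n ε>0 wn h)))
        (<-by (s m + ε - s n)
          (solve 3 (λ a b ε → ε :- (:- (a :- b)) := a :+ ε :- b) refl (s m) (s n) ε)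
          (<⇒0< (s-close n m ε>0 wm
            (subst (_< ½ * (ε * ε)) (∣∣-swap (x m) (x n)) h)))))
      (both (w→0 (½ * ε) (0<half ε>0)))
      (cx (½ * (ε * ε)) (0<half (0<* ε>0 ε>0)))

infixl 6 _+ℝ_
infixl 7 _*ℝ_
infix  8 -ℝ_

0ℝ 1ℝ : ℝ
seq    0ℝ _ = 0ℚ
cauchy 0ℝ   = Real.const-cauchy 0ℚ
seq    1ℝ _ = 1ℚ
cauchy 1ℝ   = Real.const-cauchy 1ℚ

_+ℝ_ _*ℝ_ : ℝ → ℝ → ℝ
seq    (x +ℝ y) n = seq x n ℚ.+ seq y n
cauchy (x +ℝ y)   = Real.+-cauchy (seq x) (seq y) (cauchy x) (cauchy y)
seq    (x *ℝ y) n = seq x n ℚ.* seq y n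
cauchy (x *ℝ y)   = Real.*-cauchy (seq x) (seq y) (cauchy x) (cauchy y)

-ℝ_ : ℝ → ℝ
seq    (-ℝ x) n = ℚ.- seq x n
cauchy (-ℝ x)   = Real.neg-cauchy (seq x) (cauchy x)

recipℝ : (x : ℝ) → 0ℝ <ℝ x → ℝ
seq    (recipℝ x _)   n = Real.recipℚ (seq x n)
cauchy (recipℝ x 0<x)   = Real.recip-cauchy (seq x) (gap>0 0<x)
  (eventually-map (λ n → subst (ℚ._≤ seq x n) (ℚ.+-identityˡ (gap 0<x))) (separation 0<x))
  (cauchy x)

sqrtℝ : (x : ℝ) → (∀ n → 0ℚ ℚ.≤ seq x n) → ℝ
seq    (sqrtℝ x _)   n = Real.sqrtℚ (seq x n) n
cauchy (sqrtℝ x 0≤x)   = Real.Sqrt.s-cauchy (seq x) (cauchy x) 0≤x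

module Realₚ where
  open import Data.Rational.Base using (_+_; _-_; _*_; -_; _≤_; _<_; ∣_∣)
  open +-*-Solver

  pointwise : ∀ {x y} → Eventually (λ n → seq x n ≡ seq y n) → x ≈ℝ y
  pointwise {x} {y} h = mk≈ℝ λ ε ε>0 → eventually-map
    (λ n eq → subst (_< ε)
      (sym (trans (cong (λ t → ∣ seq x n - t ∣) (sym eq))
                  (cong ∣_∣ (ℚ.+-inverseʳ (seq x n))))) ε>0) h

  ≈-refl : ∀ {x} → x ≈ℝ x
  ≈-refl = pointwise (always (λ _ → refl))

  ≈-sym : ∀ {x y} → x ≈ℝ y → y ≈ℝ x
  ≈-sym {x} {y} h = mk≈ℝ λ ε ε>0 → eventually-map
    (λ n → subst (_< ε) (∣∣-swap (seq x n) (seq y n))) (close h ε ε>0)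

  ≈-trans : ∀ {x y z} → x ≈ℝ y → y ≈ℝ z → x ≈ℝ z
  ≈-trans {x} {y} {z} h k = mk≈ℝ λ ε ε>0 → eventually-zip
    (λ n a b → subst (λ t → ∣ t ∣ < ε)
      (solve 3 (λ a b c → (a :- b) :+ (b :- c) := a :- c) refl (seq x n) (seq y n) (seq z n))
      (∣+∣< {seq x n - seq y n} {seq y n - seq z n} a b))
    (close h (½ * ε) (0<half ε>0)) (close k (½ * ε) (0<half ε>0))

  +-cong : ∀ {x y u v} → x ≈ℝ y → u ≈ℝ v → x +ℝ u ≈ℝ y +ℝ v
  +-cong {x} {y} {u} {v} h k = mk≈ℝ λ ε ε>0 → eventually-zip
    (λ n a b → subst (λ t → ∣ t ∣ < ε) (Real.+-split (seq x n) (seq u n) (seq y n) (seq v n))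
      (∣+∣< {seq x n - seq y n} {seq u n - seq v n} a b))
    (close h (½ * ε) (0<half ε>0)) (close k (½ * ε) (0<half ε>0))

  neg-cong : ∀ {x y} → x ≈ℝ y → -ℝ x ≈ℝ -ℝ y
  neg-cong {x} {y} h = mk≈ℝ λ ε ε>0 → eventually-map
    (λ n a → subst (λ t → ∣ t ∣ < ε) (Real.neg-split (seq x n) (seq y n))
      (subst (_< ε) (∣∣-swap (seq x n) (seq y n)) a))
    (close h ε ε>0)

  *-cong : ∀ {x y u v} → x ≈ℝ y → u ≈ℝ v → x *ℝ u ≈ℝ y *ℝ v
  *-cong {x} {y} {u} {v} h k = mk≈ℝ λ ε ε>0 →
    let A , A>0 , ∣x∣≤A = Real.bounded (seq x) (cauchy x)
        D , D>0 , ∣v∣≤D = Real.bounded (seq v) (cauchy v)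
        δ , δ>0 , eq    = divide (0<+ A>0 (ℚ.<⇒≤ D>0)) ε>0
    in eventually-zip
      (λ n (a , d) (b , c) →
        mul-est {seq x n} {seq u n} {seq y n} {seq v n} A>0 D>0 a d b c eq)
      (eventually-zip (λ _ → _,_) ∣x∣≤A ∣v∣≤D)
      (eventually-zip (λ _ → _,_) (close h δ δ>0) (close k δ δ>0))

------------------------------------------------------------------------
-- The complex numbers

record ℂ : Set where
  no-eta-equality
  field
    re im : ℝ

open ℂ public

infix  4 _≈ℂ_
infixl 6 _+ℂ_
infixl 7 _*ℂ_
infix  8 -ℂ_

record _≈ℂ_ (z w : ℂ) : Set where
  constructor mk≈ℂ
  field
    re≈ : re z ≈ℝ re w
    im≈ : im z ≈ℝ im w

0ℂ 1ℂ : ℂ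
re 0ℂ = 0ℝ
im 0ℂ = 0ℝ
re 1ℂ = 1ℝ
im 1ℂ = 0ℝ

_+ℂ_ _*ℂ_ : ℂ → ℂ → ℂ
re (z +ℂ w) = re z +ℝ re w
im (z +ℂ w) = im z +ℝ im w
re (z *ℂ w) = re z *ℝ re w +ℝ -ℝ (im z *ℝ im w)
im (z *ℂ w) = re z *ℝ im w +ℝ im z *ℝ re w

-ℂ_ : ℂ → ℂ
re (-ℂ z) = -ℝ re z
im (-ℂ z) = -ℝ im z

normSq : ℂ → ℝ
normSq z = re z *ℝ re z +ℝ im z *ℝ im z

normSq≥0 : ∀ z n → 0ℚ ℚ.≤ seq (normSq z) n
normSq≥0 z n = 0≤+ (0≤² (seq (re z) n)) (0≤² (seq (im z) n))

∣_∣ : ℂ → ℝ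
seq    ∣ z ∣ = seq (sqrtℝ (normSq z) (normSq≥0 z))
cauchy ∣ z ∣ = cauchy (sqrtℝ (normSq z) (normSq≥0 z))

-- z ≠ 0 in its positive (apartness) form, which is what division by z requires.
_≠0 : ℂ → Set
z ≠0 = 0ℝ <ℝ ∣ z ∣

module Complex where
  open import Data.Rational.Base using (_+_; _-_; _*_; -_; _≤_; _<_)
  open +-*-Solver

  pointwise : ∀ {z w} → (∀ n → seq (re z) n ≡ seq (re w) n) →
              (∀ n → seq (im z) n ≡ seq (im w) n) → z ≈ℂ w
  pointwise h k = mk≈ℂ (Realₚ.pointwise (always h)) (Realₚ.pointwise (always k))

  ≈-isEquivalence : IsEquivalence _≈ℂ_
  ≈-isEquivalence = record
    { refl  = mk≈ℂ Realₚ.≈-refl Realₚ.≈-refl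
    ; sym   = λ (mk≈ℂ h k) → mk≈ℂ (Realₚ.≈-sym h) (Realₚ.≈-sym k)
    ; trans = λ (mk≈ℂ h k) (mk≈ℂ h′ k′) → mk≈ℂ (Realₚ.≈-trans h h′) (Realₚ.≈-trans k k′)
    }

  +-cong : ∀ {z w u v} → z ≈ℂ w → u ≈ℂ v → z +ℂ u ≈ℂ w +ℂ v
  +-cong (mk≈ℂ h k) (mk≈ℂ h′ k′) = mk≈ℂ (Realₚ.+-cong h h′) (Realₚ.+-cong k k′)

  neg-cong : ∀ {z w} → z ≈ℂ w → -ℂ z ≈ℂ -ℂ w
  neg-cong (mk≈ℂ h k) = mk≈ℂ (Realₚ.neg-cong h) (Realₚ.neg-cong k)

  *-cong : ∀ {z w u v} → z ≈ℂ w → u ≈ℂ v → z *ℂ u ≈ℂ w *ℂ v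
  *-cong (mk≈ℂ h k) (mk≈ℂ h′ k′) = mk≈ℂ
    (Realₚ.+-cong (Realₚ.*-cong h h′) (Realₚ.neg-cong (Realₚ.*-cong k k′)))
    (Realₚ.+-cong (Realₚ.*-cong h k′) (Realₚ.*-cong k h′))

  +-assoc : ∀ z w u → (z +ℂ w) +ℂ u ≈ℂ z +ℂ (w +ℂ u)
  +-assoc z w u = pointwise
    (λ n → ℚ.+-assoc (seq (re z) n) (seq (re w) n) (seq (re u) n))
    (λ n → ℚ.+-assoc (seq (im z) n) (seq (im w) n) (seq (im u) n))

  +-comm : ∀ z w → z +ℂ w ≈ℂ w +ℂ z
  +-comm z w = pointwise (λ n → ℚ.+-comm (seq (re z) n) (seq (re w) n))
                         (λ n → ℚ.+-comm (seq (im z) n) (seq (im w) n))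

  +-identityˡ : ∀ z → 0ℂ +ℂ z ≈ℂ z
  +-identityˡ z = pointwise (λ n → ℚ.+-identityˡ (seq (re z) n))
                            (λ n → ℚ.+-identityˡ (seq (im z) n))

  +-identityʳ : ∀ z → z +ℂ 0ℂ ≈ℂ z
  +-identityʳ z = pointwise (λ n → ℚ.+-identityʳ (seq (re z) n))
                            (λ n → ℚ.+-identityʳ (seq (im z) n))

  +-inverseˡ : ∀ z → -ℂ z +ℂ z ≈ℂ 0ℂ
  +-inverseˡ z = pointwise (λ n → ℚ.+-inverseˡ (seq (re z) n))
                           (λ n → ℚ.+-inverseˡ (seq (im z) n))

  +-inverseʳ : ∀ z → z +ℂ -ℂ z ≈ℂ 0ℂ
  +-inverseʳ z = pointwise (λ n → ℚ.+-inverseʳ (seq (re z) n))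
                           (λ n → ℚ.+-inverseʳ (seq (im z) n))

  *-assoc : ∀ z w u → (z *ℂ w) *ℂ u ≈ℂ z *ℂ (w *ℂ u)
  *-assoc z w u = pointwise
    (λ n → solve 6 (λ a b c d e f →
        (a :* c :+ :- (b :* d)) :* e :+ :- ((a :* d :+ b :* c) :* f)
        := a :* (c :* e :+ :- (d :* f)) :+ :- (b :* (c :* f :+ d :* e))) refl
      (seq (re z) n) (seq (im z) n) (seq (re w) n) (seq (im w) n) (seq (re u) n) (seq (im u) n))
    (λ n → solve 6 (λ a b c d e f →
        (a :* c :+ :- (b :* d)) :* f :+ (a :* d :+ b :* c) :* e
        := a :* (c :* f :+ d :* e) :+ b :* (c :* e :+ :- (d :* f))) refl
      (seq (re z) n) (seq (im z) n) (seq (re w) n) (seq (im w) n) (seq (re u) n) (seq (im u) n))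

  *-comm : ∀ z w → z *ℂ w ≈ℂ w *ℂ z
  *-comm z w = pointwise
    (λ n → solve 4 (λ a b c d → a :* c :+ :- (b :* d) := c :* a :+ :- (d :* b)) refl
      (seq (re z) n) (seq (im z) n) (seq (re w) n) (seq (im w) n))
    (λ n → solve 4 (λ a b c d → a :* d :+ b :* c := c :* b :+ d :* a) refl
      (seq (re z) n) (seq (im z) n) (seq (re w) n) (seq (im w) n))

  *-identityˡ : ∀ z → 1ℂ *ℂ z ≈ℂ z
  *-identityˡ z = pointwise
    (λ n → solve 2 (λ a b → con 1ℚ :* a :+ :- (con 0ℚ :* b) := a) refl
      (seq (re z) n) (seq (im z) n))
    (λ n → solve 2 (λ a b → con 1ℚ :* b :+ con 0ℚ :* a := b) refl
      (seq (re z) n) (seq (im z) n))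

  *-distribˡ : ∀ z w u → z *ℂ (w +ℂ u) ≈ℂ z *ℂ w +ℂ z *ℂ u
  *-distribˡ z w u = pointwise
    (λ n → solve 6 (λ a b c d e f →
        a :* (c :+ e) :+ :- (b :* (d :+ f))
        := (a :* c :+ :- (b :* d)) :+ (a :* e :+ :- (b :* f))) refl
      (seq (re z) n) (seq (im z) n) (seq (re w) n) (seq (im w) n) (seq (re u) n) (seq (im u) n))
    (λ n → solve 6 (λ a b c d e f →
        a :* (d :+ f) :+ b :* (c :+ e)
        := (a :* d :+ b :* c) :+ (a :* f :+ b :* e)) refl
      (seq (re z) n) (seq (im z) n) (seq (re w) n) (seq (im w) n) (seq (re u) n) (seq (im u) n))

  module _ where
    open IsEquivalence ≈-isEquivalence renaming (trans to ≈-trans)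

    *-identityʳ : ∀ z → z *ℂ 1ℂ ≈ℂ z
    *-identityʳ z = ≈-trans (*-comm z 1ℂ) (*-identityˡ z)

    *-distribʳ : ∀ z w u → (w +ℂ u) *ℂ z ≈ℂ w *ℂ z +ℂ u *ℂ z
    *-distribʳ z w u = ≈-trans (*-comm (w +ℂ u) z)
      (≈-trans (*-distribˡ z w u) (+-cong (*-comm z w) (*-comm z u)))

  -- Passing between ∣ z ∣ and re² + im², termwise on approximating sequences.

  N : ℂ → ℕ → ℚ
  N z n = seq (normSq z) n

  module _ (z : ℂ) where
    open Real.Sqrt (seq (normSq z)) (cauchy (normSq z)) (normSq≥0 z) public

  record Apart (z : ℂ) : Set where
    constructor apart
    field
      δ    : ℚ
      δ>0  : 0ℚ < δ
      away : Eventually (λ n → δ ≤ N z n)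

  record Inside (z : ℂ) : Set where
    constructor inside
    field
      δ      : ℚ
      δ>0    : 0ℚ < δ
      within : Eventually (λ n → N z n ≤ 1ℚ - δ)

  ∣z∣²≈normSq : ∀ z → ∣ z ∣ *ℝ ∣ z ∣ ≈ℝ normSq z
  ∣z∣²≈normSq z = mk≈ℝ λ ε ε>0 →
    let B , B>0 , ∣N∣≤B = Real.bounded (N z) (cauchy (normSq z))
        C               = (1ℚ + 1ℚ) * (1ℚ + B) + 1ℚ
        0<1+B           = 0<+ 0<1 (ℚ.<⇒≤ B>0)
        C>0             = 0<+ (0<* (0<+ 0<1 (ℚ.<⇒≤ 0<1)) 0<1+B) (ℚ.<⇒≤ 0<1)
        δ , δ>0 , eq    = divide C>0 ε>0
    in eventually-zip
      (λ n b (w<1 , w<δ) →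
        let open Real.Brackets (s-brackets z n) using ()
              renaming (nonneg to 0≤s; lower to l; upper to u)
            y = s z n
            v = w z n
            c = N z n
            c≤B = ℚ.≤-trans (≤∣∣ c) b
            0≤v = 0≤* (0≤+ (ℚ.<⇒≤ 0<1) (normSq≥0 z n)) (ℚ.<⇒≤ (Real.½^>0 n))
            -- y ≤ (1 + y²) / 2 ≤ 1 + B
            y≤1+B : y ≤ 1ℚ + B
            y≤1+B = ≤-by (½ * ((1ℚ - y) * (1ℚ - y) + ((B - c) + (c - y * y)) + (1ℚ + B)))
              (solve 3 (λ y B c → con 1ℚ :+ B :- y
                 := con ½ :* ((con 1ℚ :- y) :* (con 1ℚ :- y) :+ ((B :- c) :+ (c :- y :* y))
                      :+ (con 1ℚ :+ B))) refl y B c)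
              (0≤* (ℚ.<⇒≤ 0<½) (0≤+ (0≤+ (0≤² (1ℚ - y)) (0≤+ (≤⇒0≤ c≤B) (≤⇒0≤ l)))
                (ℚ.<⇒≤ 0<1+B)))
        in ∣∣<-by
          (ℚ.≤-<-trans (≤-by (c - y * y)
            (solve 2 (λ y c → con 0ℚ :- (y :* y :- c) := c :- y :* y) refl y c) (≤⇒0≤ l)) ε>0)
          (subst (- (y * y - c) <_) eq
            (<-by (C * (δ - v) + (((y + v) * (y + v) - c)
                + ((1ℚ + 1ℚ) * (v * (1ℚ + B - y)) + v * (1ℚ - v))))
              (solve 5 (λ y v c B δ →
                 ((con 1ℚ :+ con 1ℚ) :* (con 1ℚ :+ B) :+ con 1ℚ) :* δ :- (:- (y :* y :- c))
                 := ((con 1ℚ :+ con 1ℚ) :* (con 1ℚ :+ B) :+ con 1ℚ) :* (δ :- v)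
                   :+ (((y :+ v) :* (y :+ v) :- c)
                   :+ ((con 1ℚ :+ con 1ℚ) :* (v :* (con 1ℚ :+ B :- y)) :+ v :* (con 1ℚ :- v))))
                refl y v c B δ)
              (0<+ (0<* C>0 (<⇒0< w<δ)) (0≤+ (≤⇒0≤ (ℚ.<⇒≤ u))
                (0≤+ (0≤* (0≤+ (ℚ.<⇒≤ 0<1) (ℚ.<⇒≤ 0<1)) (0≤* 0≤v (≤⇒0≤ y≤1+B)))
                     (0≤* 0≤v (≤⇒0≤ (ℚ.<⇒≤ w<1)))))))))
      ∣N∣≤B (eventually-zip (λ _ → _,_) (w→0 z 1ℚ 0<1) (w→0 z δ δ>0))

  ≠0⇒Apart : ∀ {z} → z ≠0 → Apart z
  ≠0⇒Apart {z} (mk<ℝ δ δ>0 sep) = apart (δ * δ) (0<* δ>0 δ>0) (eventually-map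
    (λ n h → ℚ.≤-trans
      (²-mono-≤ (ℚ.<⇒≤ δ>0) (subst (_≤ s z n) (ℚ.+-identityˡ δ) h))
      (Real.lower (s-brackets z n)))
    sep)

  -- With η = ¼ ⊓ δ and w < η, s < η would give N z < (2η)² ≤ η ≤ δ.
  Apart⇒≠0 : ∀ {z} → Apart z → z ≠0
  Apart⇒≠0 {z} (apart δ δ>0 h) = mk<ℝ η η>0 (eventually-zip
    (λ n δ≤N w<η → subst (_≤ s z n) (sym (ℚ.+-identityˡ η)) (ℚ.≮⇒≥ λ s<η →
      let open Real.Brackets (s-brackets z n) using () renaming (nonneg to 0≤s; upper to u)
      in ℚ.<-irrefl refl (ℚ.<-≤-trans (ℚ.≤-<-trans δ≤N u)
        (ℚ.≤-trans
          (²-mono-≤ (0≤+ 0≤s (0≤w n)) (ℚ.+-mono-≤ (ℚ.<⇒≤ s<η) (ℚ.<⇒≤ w<η)))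
          [2η]²≤δ))))
    h (w→0 z η η>0))
    where
    ¼ = ½ * ½
    η = ¼ ℚ.⊓ δ
    η>0 : 0ℚ < η
    η>0 with ℚ.≤-total ¼ δ
    ... | inj₁ le = subst (0ℚ <_) (sym (ℚ.p≤q⇒p⊓q≡p le)) (0<half 0<½)
    ... | inj₂ ge = subst (0ℚ <_) (sym (ℚ.p≥q⇒p⊓q≡q ge)) δ>0
    0≤w : ∀ n → 0ℚ ≤ w z n
    0≤w n = 0≤* (0≤+ (ℚ.<⇒≤ 0<1) (normSq≥0 z n)) (ℚ.<⇒≤ (Real.½^>0 n))
    [2η]²≤δ : (η + η) * (η + η) ≤ δ
    [2η]²≤δ = ≤-by ((δ - η) + (1ℚ + 1ℚ) * (1ℚ + 1ℚ) * (η * (¼ - η)))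
      (solve 2 (λ δ η → δ :- (η :+ η) :* (η :+ η) :=
          (δ :- η) :+ (con 1ℚ :+ con 1ℚ) :* (con 1ℚ :+ con 1ℚ)
            :* (η :* (con ½ :* con ½ :- η))) refl δ η)
      (0≤+ (≤⇒0≤ (ℚ.p⊓q≤q ¼ δ))
        (0≤* (ℚ.<⇒≤ (ℚ.positive⁻¹ ((1ℚ + 1ℚ) * (1ℚ + 1ℚ))))
          (0≤* (ℚ.<⇒≤ η>0) (≤⇒0≤ (ℚ.p⊓q≤p ¼ δ)))))

  <1⇒Inside : ∀ {z} → ∣ z ∣ <ℝ 1ℝ → Inside z
  <1⇒Inside {z} (mk<ℝ δ δ>0 sep) = inside (½ * δ) (0<half δ>0) (eventually-zip
    (λ n s+δ≤1 w< →
      let open Real.Brackets (s-brackets z n) using () renaming (nonneg to 0≤s; upper to u)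
          t = 1ℚ - ½ * δ
          0≤w = 0≤* (0≤+ (ℚ.<⇒≤ 0<1) (normSq≥0 z n)) (ℚ.<⇒≤ (Real.½^>0 n))
          s+w≤t : s z n + w z n ≤ t
          s+w≤t = ≤-by ((1ℚ - (s z n + δ)) + (½ * δ - w z n))
            (solve 3 (λ s δ w → con 1ℚ :- con ½ :* δ :- (s :+ w)
              := (con 1ℚ :- (s :+ δ)) :+ (con ½ :* δ :- w)) refl (s z n) δ (w z n))
            (0≤+ (≤⇒0≤ s+δ≤1) (ℚ.<⇒≤ (<⇒0< w<)))
          0≤s+w = 0≤+ 0≤s 0≤w
          0≤t = ℚ.≤-trans 0≤s+w s+w≤t
          t²≤t : t * t ≤ t
          t²≤t = ≤-by (t * (½ * δ))
            (solve 1 (λ δ → (con 1ℚ :- con ½ :* δ) :- (con 1ℚ :- con ½ :* δ) :* (con 1ℚ :- con ½ :* δ)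
              := (con 1ℚ :- con ½ :* δ) :* (con ½ :* δ)) refl δ)
            (0≤* 0≤t (ℚ.<⇒≤ (0<half δ>0)))
      in ℚ.≤-trans (ℚ.<⇒≤ u) (ℚ.≤-trans (²-mono-≤ 0≤s+w s+w≤t) t²≤t))
    sep (w→0 z (½ * δ) (0<half δ>0)))

  N-* : ∀ z w n → N (z *ℂ w) n ≡ N z n * N w n
  N-* z w n = solve 4 (λ a b c d →
      (a :* c :+ :- (b :* d)) :* (a :* c :+ :- (b :* d))
        :+ (a :* d :+ b :* c) :* (a :* d :+ b :* c)
      := (a :* a :+ b :* b) :* (c :* c :+ d :* d)) refl
    (seq (re z) n) (seq (im z) n) (seq (re w) n) (seq (im w) n)

  *-≠0 : ∀ {z w} → z ≠0 → w ≠0 → (z *ℂ w) ≠0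
  *-≠0 {z} {w} z≠0 w≠0 =
    let apart δ δ>0 h = ≠0⇒Apart z≠0
        apart η η>0 k = ≠0⇒Apart w≠0
    in Apart⇒≠0 (apart (δ * η) (0<* δ>0 η>0) (eventually-zip
      (λ n a b → subst (δ * η ≤_) (sym (N-* z w n))
        (≤-by ((N z n - δ) * N w n + δ * (N w n - η))
          (solve 4 (λ x y d e → x :* y :- d :* e := (x :- d) :* y :+ d :* (y :- e))
            refl (N z n) (N w n) δ η)
          (0≤+ (0≤* (≤⇒0≤ a) (normSq≥0 w n)) (0≤* (ℚ.<⇒≤ δ>0) (≤⇒0≤ b)))))
      h k))

  1≠0 : 1ℂ ≠0
  1≠0 = Apart⇒≠0 (apart 1ℚ 0<1 (always λ n → ℚ.≤-refl))

  Inside-* : ∀ {z w} → Inside z → Eventually (λ n → N w n ≤ 1ℚ) → Inside (z *ℂ w)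
  Inside-* {z} {w} (inside δ δ>0 h) k = inside δ δ>0 (eventually-zip
    (λ n a b → subst (_≤ 1ℚ - δ) (sym (N-* z w n))
      (≤-by ((1ℚ - δ - N z n) + N z n * (1ℚ - N w n))
        (solve 3 (λ x y δ → con 1ℚ :- δ :- x :* y
          := (con 1ℚ :- δ :- x) :+ x :* (con 1ℚ :- y)) refl (N z n) (N w n) δ)
        (0≤+ (≤⇒0≤ a) (0≤* (normSq≥0 z n) (≤⇒0≤ b)))))
    h k)

  Inside⇒≤1 : ∀ {z} → Inside z → Eventually (λ n → N z n ≤ 1ℚ)
  Inside⇒≤1 {z} (inside δ δ>0 h) = eventually-map
    (λ n a → ≤-by ((1ℚ - δ - N z n) + δ)
      (solve 2 (λ x δ → con 1ℚ :- x := (con 1ℚ :- δ :- x) :+ δ) refl (N z n) δ)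
      (0≤+ (≤⇒0≤ a) (ℚ.<⇒≤ δ>0))) h

  -- 4 N(1 - z) ≥ (2 - 2 Re z)², and 2 Re z ≤ 1 + N z ≤ 2 - δ.
  Inside⇒1-≠0 : ∀ {z} → Inside z → (1ℂ +ℂ -ℂ z) ≠0
  Inside⇒1-≠0 {z} (inside δ δ>0 h) = Apart⇒≠0
    (apart ((½ * δ) * (½ * δ)) (0<* (0<half δ>0) (0<half δ>0)) (eventually-map
      (λ n a →
        let x = seq (re z) n
            y = seq (im z) n
            ½δ≤1-x : ½ * δ ≤ 1ℚ - x
            ½δ≤1-x = ≤-by (½ * ((1ℚ - δ - N z n) + ((1ℚ - x) * (1ℚ - x) + y * y)))
              (solve 3 (λ x y δ → con 1ℚ :- x :- con ½ :* δ
                := con ½ :* ((con 1ℚ :- δ :- (x :* x :+ y :* y))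
                     :+ ((con 1ℚ :- x) :* (con 1ℚ :- x) :+ y :* y))) refl x y δ)
              (0≤* (ℚ.<⇒≤ 0<½)
                (0≤+ (≤⇒0≤ a) (0≤+ (0≤² (1ℚ - x)) (0≤² y))))
        in ℚ.≤-trans (²-mono-≤ (ℚ.<⇒≤ (0<half δ>0)) ½δ≤1-x)
          (≤-by (y * y)
            (solve 2 (λ x y → (con 1ℚ :+ :- x) :* (con 1ℚ :+ :- x)
                :+ (con 0ℚ :+ :- y) :* (con 0ℚ :+ :- y) :- (con 1ℚ :- x) :* (con 1ℚ :- x)
                := y :* y) refl x y)
            (0≤² y)))
      h))

  normSq>0 : ∀ {z} → z ≠0 → 0ℝ <ℝ normSq z
  normSq>0 {z} z≠0 =
    let apart δ δ>0 h = ≠0⇒Apart z≠0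
    in mk<ℝ δ δ>0 (eventually-map (λ n → subst (_≤ N z n) (sym (ℚ.+-identityˡ δ))) h)

ℂ-commutativeRing : CommutativeRing 0ℓ 0ℓ
ℂ-commutativeRing = record
  { Carrier = ℂ
  ; _≈_     = _≈ℂ_
  ; _+_     = _+ℂ_
  ; _*_     = _*ℂ_
  ; -_      = -ℂ_
  ; 0#      = 0ℂ
  ; 1#      = 1ℂ
  ; isCommutativeRing = record
    { isRing = record
      { +-isAbelianGroup = record
        { isGroup = record
          { isMonoid = record
            { isSemigroup = record
              { isMagma = record
                { isEquivalence = Complex.≈-isEquivalence ; ∙-cong = Complex.+-cong }
              ; assoc = Complex.+-assoc
              }
            ; identity = Complex.+-identityˡ , Complex.+-identityʳ
            }
          ; inverse = Complex.+-inverseˡ , Complex.+-inverseʳ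
          ; ⁻¹-cong = Complex.neg-cong
          }
        ; comm = Complex.+-comm
        }
      ; *-cong     = Complex.*-cong
      ; *-assoc    = Complex.*-assoc
      ; *-identity = Complex.*-identityˡ , Complex.*-identityʳ
      ; distrib    = Complex.*-distribˡ , Complex.*-distribʳ
      }
    ; *-comm = Complex.*-comm
    }
  }

-- 1 / z = z̄ / ∣ z ∣²
inv : (z : ℂ) → z ≠0 → ℂ
re (inv z z≠0) = re z *ℝ recipℝ (normSq z) (Complex.normSq>0 z≠0)
im (inv z z≠0) = -ℝ im z *ℝ recipℝ (normSq z) (Complex.normSq>0 z≠0)

inv-inverseʳ : ∀ z (z≠0 : z ≠0) → z *ℂ inv z z≠0 ≈ℂ 1ℂ
inv-inverseʳ z z≠0 = mk≈ℂ
  (Realₚ.pointwise (eventually-map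
    (λ n 0<N → trans
      (solve 3 (λ x y r → x :* (x :* r) :+ :- (y :* ((:- y) :* r)) := (x :* x :+ y :* y) :* r)
        refl (seq (re z) n) (seq (im z) n) (Real.recipℚ (Complex.N z n)))
      (Real.recipℚ-inverse 0<N))
    N>0))
  (Realₚ.pointwise (always λ n →
    solve 3 (λ x y r → x :* ((:- y) :* r) :+ y :* (x :* r) := con 0ℚ)
      refl (seq (re z) n) (seq (im z) n) (Real.recipℚ (Complex.N z n))))
  where
  open +-*-Solver
  N>0 : Eventually (λ n → 0ℚ ℚ.< Complex.N z n)
  N>0 = let Complex.apart δ δ>0 h = Complex.≠0⇒Apart z≠0
        in eventually-map (λ n → ℚ.<-≤-trans δ>0) h

------------------------------------------------------------------------
-- q-series

open CommutativeRing ℂ-commutativeRing public using (_≈_; _+_; _*_; -_; _-_)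
open import Algebra.Properties.Semiring.Exp (CommutativeRing.semiring ℂ-commutativeRing) public
  using (_^_)
open import Algebra.Properties.CommutativeMonoid.Sum
  (CommutativeRing.+-commutativeMonoid ℂ-commutativeRing) public using (sum-syntax)

infixl 7 _/_[_]

_/_[_] : ℂ → (z : ℂ) → z ≠0 → ℂ
w / z [ z≠0 ] = w * inv z z≠0

infixr 8 _^_[_]

_^_[_] : (z : ℂ) → ℤ → z ≠0 → ℂ
z ^ + n      [ _   ] = z ^ n
z ^ -[1+ n ] [ z≠0 ] = inv z z≠0 ^ suc n

infix 9 ⟨_⨾_⟩_

-- (a ; q)ₙ = ∏_{j=1}^{n} (1 - a q^{j-1})
⟨_⨾_⟩_ : ℂ → ℂ → ℕ → ℂ
⟨ a ⨾ q ⟩ zero  = 1ℂ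
⟨ a ⨾ q ⟩ suc n = ⟨ a ⨾ q ⟩ n * (1ℂ - a * q ^ n)

⟨q⨾q⟩≠0 : ∀ {q} → ∣ q ∣ <ℝ 1ℝ → ∀ n → (⟨ q ⨾ q ⟩ n) ≠0
⟨q⨾q⟩≠0 {q} ∣q∣<1 zero    = Complex.1≠0
⟨q⨾q⟩≠0 {q} ∣q∣<1 (suc n) = Complex.*-≠0
  (⟨q⨾q⟩≠0 ∣q∣<1 n)
  (Complex.Inside⇒1-≠0 (Complex.Inside-* {q} {q ^ n} q-inside (pow≤1 n)))
  where
  q-inside = Complex.<1⇒Inside ∣q∣<1
  pow≤1 : ∀ n → Eventually (λ k → Complex.N (q ^ n) k ℚ.≤ 1ℚ)
  pow≤1 zero    = always λ _ → ℚ.≤-refl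
  pow≤1 (suc n) = Complex.Inside⇒≤1 {q * q ^ n} (Complex.Inside-* {q} {q ^ n} q-inside (pow≤1 n))

-- m (m - 1) is even and nonnegative for every integer m, so both the division and the
-- absolute value (which makes this usable as an exponent of q, even for q = 0) are exact.
choose₂ : ℤ → ℕ
choose₂ m = ℤ.∣ (m ℤ.* (m ℤ.- 1ℤ)) ℤ./ + 2 ∣

-- The sum of f k over the integers a ≤ k ≤ b.
sumFromTo : ℤ → ℤ → (ℤ → ℂ) → ℂ
sumFromTo a b f = ∑[ i < ℤ.∣ 0ℤ ℤ.⊔ (b ℤ.- a ℤ.+ 1ℤ) ∣ ] f (a ℤ.+ + toℕ i)

infixl 10 sumFromTo

syntax sumFromTo a b (λ k → x) = ∑[ k from a to b ] x

-- The case a = 1, λ = 1. For - n - 1 ≤ k ≤ n the indices n - k and n + k + 1 are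
-- nonnegative, so their absolute values below are harmless.
IsAsymmetricBilateralBaileyPair : (q : ℂ) → ∣ q ∣ <ℝ 1ℝ → (ℤ → ℂ) → (ℕ → ℂ) → Set
IsAsymmetricBilateralBaileyPair q ∣q∣<1 α β = ∀ n →
  β n ≈ ∑[ k from ℤ.- (+ n) ℤ.- 1ℤ to + n ]
    (let i = ℤ.∣ + n ℤ.- k ∣
         j = ℤ.∣ + n ℤ.+ k ℤ.+ 1ℤ ∣
     in α k / (⟨ q ⨾ q ⟩ i * ⟨ q ⨾ q ⟩ j)
          [ Complex.*-≠0 (⟨q⨾q⟩≠0 ∣q∣<1 i) (⟨q⨾q⟩≠0 ∣q∣<1 j) ])

{-# OPTIONS --safe #-}

-- Multiplied by (q)₂ₙ₊₁, the claim is the case m = n + 1 of the finite Jacobi triple product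
--   ∑ᵢ [m+n, i] α(i - m) = (-1/z)ₘ (-zq)ₙ   (0 ≤ i ≤ m + n),
-- where [N, i] is the q-binomial coefficient. The Pascal rule
-- [N+1, i+1] = q^{i+1} [N, i+1] + [N, i] turns the sum of f over row N + 1 into the sum of
-- q^i f(i) + f(i+1) over row N. Since q^i α(i-m-1) = z⁻¹ q^m α(i-m), raising m by one
-- multiplies the sum by 1 + z⁻¹ q^m; the case m = 0 is Rothe's q-binomial theorem, where
-- the same rule replaces z by zq. No power of q is ever inverted, so q = 0 is allowed.
module Submission where

open import Defs
open import Data.Integer.Base using (1ℤ) renaming (_+_ to _+ℤ_)
open import Data.Nat.Base using () renaming (_+_ to _+ℕ_; _*_ to _*ℕ_)

open import Algebra.Bundles using (CommutativeRing)
open import Algebra.Properties.CommutativeSemiring.Exp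
  (CommutativeRing.commutativeSemiring ℂ-commutativeRing)
  using (^-congʳ; ^-homo-*; ^-distrib-*)
open import Algebra.Properties.Ring (CommutativeRing.ring ℂ-commutativeRing)
  using (-‿distribˡ-*; -‿distribʳ-*; -‿involutive)
open import Algebra.Properties.Semiring.Sum (CommutativeRing.semiring ℂ-commutativeRing)
  using (sum-cong-≋; ∑-distrib-+; *-distribˡ-sum; *-distribʳ-sum)
open import Data.Fin.Base using (toℕ)
open import Data.Fin.Properties using (toℕ≤pred[n])
open import Data.Integer.Base as ℤ using (ℤ; +_; -[1+_]; _⊖_)
import Data.Integer.DivMod as ℤ
import Data.Integer.Properties as ℤ
import Data.Integer.Solver as ℤ-Solver
open import Data.Nat.Base as ℕ using (ℕ; zero; suc)
open import Data.Nat.Divisibility using (divides-refl)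
import Data.Nat.DivMod as ℕ
import Data.Nat.Properties as ℕ
import Data.Nat.Solver as ℕ-Solver
open import Relation.Binary.PropositionalEquality as ≡ using (_≡_)
import Relation.Binary.Reasoning.Setoid as SetoidReasoning

open CommutativeRing ℂ-commutativeRing
  using (refl; sym; trans; reflexive; setoid; +-cong; +-congˡ; +-congʳ; +-assoc; *-cong;
    *-congˡ; *-congʳ; *-assoc; *-comm; -‿cong; -‿inverseʳ; zeroˡ; zeroʳ; +-identityˡ;
    +-identityʳ; *-identityˡ; *-identityʳ)

-- Binomial exponents at integer arguments

module _ where
  open ≡.≡-Reasoning
  open ℕ-Solver.+-*-Solver

  -- Once the product is a natural number, integer division and the absolute value collapse to
  -- division in `ℕ`, where the recursions below are computed.
  choose₂-half : ∀ m {k} → m ℤ.* (m ℤ.- 1ℤ) ≡ + k → choose₂ m ≡ k ℕ./ 2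
  choose₂-half m {k} eq =
    ≡.cong ℤ.∣_∣ (≡.trans (≡.cong (ℤ._/ + 2) eq) (ℤ.div-pos-is-/ℕ (+ k) 2))

  [m*2+n]/2≡m+n/2 : ∀ m n → (m *ℕ 2 +ℕ n) ℕ./ 2 ≡ m +ℕ n ℕ./ 2
  [m*2+n]/2≡m+n/2 m n = ≡.trans (ℕ.+-distrib-/-∣ˡ n (divides-refl m))
    (≡.cong (_+ℕ n ℕ./ 2) (ℕ.m*n/n≡m m 2))

  choose₂-pos : ∀ n → choose₂ (+ suc n) ≡ n +ℕ choose₂ (+ n)
  choose₂-pos zero    = ≡.refl
  choose₂-pos (suc n) = begin
    choose₂ (+ suc (suc n))
      ≡⟨ choose₂-half (+ suc (suc n)) (≡.sym (ℤ.pos-* (suc (suc n)) (suc n))) ⟩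
    (suc (suc n) *ℕ suc n) ℕ./ 2
      ≡⟨ ≡.cong (ℕ._/ 2) (solve 1 (λ n → (con 2 :+ n) :* (con 1 :+ n)
           := (con 1 :+ n) :* con 2 :+ (con 1 :+ n) :* n) ≡.refl n) ⟩
    (suc n *ℕ 2 +ℕ suc n *ℕ n) ℕ./ 2
      ≡⟨ [m*2+n]/2≡m+n/2 (suc n) (suc n *ℕ n) ⟩
    suc n +ℕ (suc n *ℕ n) ℕ./ 2
      ≡⟨ ≡.cong (suc n +ℕ_) (choose₂-half (+ suc n) (≡.sym (ℤ.pos-* (suc n) n))) ⟨
    suc n +ℕ choose₂ (+ suc n) ∎

  -- This is the rule choose₂ (k + 1) = choose₂ k + k at k = -n - 1, with the negative summand moved
  -- to the other side.
  choose₂-neg : ∀ n → choose₂ -[1+ n ] ≡ suc n +ℕ choose₂ (ℤ.- + n)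
  choose₂-neg zero    = ≡.refl
  choose₂-neg (suc n) = begin
    choose₂ -[1+ suc n ]
      ≡⟨ half (suc n) ⟩
    (suc (suc n) *ℕ suc (suc (suc n))) ℕ./ 2
      ≡⟨ ≡.cong (ℕ._/ 2) (solve 1 (λ n → (con 2 :+ n) :* (con 3 :+ n)
           := (con 2 :+ n) :* con 2 :+ (con 1 :+ n) :* (con 2 :+ n)) ≡.refl n) ⟩
    (suc (suc n) *ℕ 2 +ℕ suc n *ℕ suc (suc n)) ℕ./ 2
      ≡⟨ [m*2+n]/2≡m+n/2 (suc (suc n)) (suc n *ℕ suc (suc n)) ⟩
    suc (suc n) +ℕ (suc n *ℕ suc (suc n)) ℕ./ 2
      ≡⟨ ≡.cong (suc (suc n) +ℕ_) (half n) ⟨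
    suc (suc n) +ℕ choose₂ -[1+ n ] ∎
    where
    half : ∀ n → choose₂ -[1+ n ] ≡ (suc n *ℕ suc (suc n)) ℕ./ 2
    half n = choose₂-half -[1+ n ] (≡.cong (λ j → + (suc n *ℕ suc (suc j))) (ℕ.+-identityʳ n))

  -- The Pascal rule choose₂ (k + 1) = choose₂ k + k at k = i - m, with m moved across so
  -- that both sides are natural numbers.
  choose₂-⊖ : ∀ i m → i +ℕ choose₂ (i ⊖ m) ≡ m +ℕ choose₂ (i ⊖ m +ℤ 1ℤ)
  -- Common successors cancel in `i ⊖ m`, so the recursion ends at a nonnegative or a negative
  -- integer, handled by `choose₂-pos` or `choose₂-neg`.
  choose₂-⊖ (suc i) (suc m) rewrite ℤ.[1+m]⊖[1+n]≡m⊖n i m = ≡.cong suc (choose₂-⊖ i m)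
  choose₂-⊖ i       zero    =
    ≡.sym (≡.trans (≡.cong (λ n → choose₂ (+ n)) (ℕ.+-comm i 1)) (choose₂-pos i))
  choose₂-⊖ zero    (suc m) = ≡.trans (choose₂-neg m) (≡.cong (λ k → suc m +ℕ choose₂ k) (-n≡1⊖[1+n] m))
    where
    -n≡1⊖[1+n] : ∀ n → ℤ.- + n ≡ 1 ⊖ suc n
    -n≡1⊖[1+n] zero    = ≡.refl
    -n≡1⊖[1+n] (suc n) = ≡.refl

  ⊖-suc : ∀ i m → i ⊖ suc m +ℤ 1ℤ ≡ i ⊖ m
  ⊖-suc i m = ≡.trans (ℤ.distribˡ-⊖-+-pos 1 i (suc m))
    (≡.trans (≡.cong (_⊖ suc m) (ℕ.+-comm i 1)) (ℤ.[1+m]⊖[1+n]≡m⊖n i m))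

-- Indices of the Bailey sum, counted from zero

module _ (n : ℕ) where
  open ≡.≡-Reasoning
  open ℤ-Solver.+-*-Solver

  private
    a = ℤ.- (+ n) ℤ.- 1ℤ

  n-a+1≡2n+2 : + n ℤ.- a +ℤ 1ℤ ≡ + suc (2 *ℕ n +ℕ 1)
  n-a+1≡2n+2 = begin
    + n ℤ.- a +ℤ 1ℤ
      ≡⟨ solve 1 (λ n → n :- (:- n :- con 1ℤ) :+ con 1ℤ := con 1ℤ :+ (con (+ 2) :* n :+ con 1ℤ))
           ≡.refl (+ n) ⟩
    1ℤ +ℤ (+ 2 ℤ.* + n +ℤ 1ℤ)
      ≡⟨ ≡.cong (λ k → 1ℤ +ℤ (k +ℤ 1ℤ)) (ℤ.pos-* 2 n) ⟨
    + suc (2 *ℕ n +ℕ 1) ∎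

  a+i≡i⊖[1+n] : ∀ i → a +ℤ + i ≡ i ⊖ suc n
  a+i≡i⊖[1+n] i = ≡.cong (_+ℤ + i) (≡.trans (≡.sym (ℤ.neg-distrib-+ (+ n) 1ℤ))
    (≡.cong (λ j → ℤ.- + j) (ℕ.+-comm n 1)))

  ∣n+[a+i]+1∣≡i : ∀ i → ℤ.∣ + n +ℤ (a +ℤ + i) +ℤ 1ℤ ∣ ≡ i
  ∣n+[a+i]+1∣≡i i = ≡.cong ℤ.∣_∣ (solve 2
    (λ n i → n :+ (:- n :- con 1ℤ :+ i) :+ con 1ℤ := i) ≡.refl (+ n) (+ i))

  -- The complement enters as a `j` with `i +ℕ j ≡ 2 *ℕ n +ℕ 1`, so that no truncated subtraction
  -- has to be related to integer subtraction.
  ∣n-[a+i]∣≡j : ∀ i {j} → i +ℕ j ≡ 2 *ℕ n +ℕ 1 → ℤ.∣ + n ℤ.- (a +ℤ + i) ∣ ≡ j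
  ∣n-[a+i]∣≡j i {j} i+j≡2n+1 = ≡.cong ℤ.∣_∣ (begin
    + n ℤ.- (a +ℤ + i)
      ≡⟨ solve 2 (λ n i → n :- (:- n :- con 1ℤ :+ i) := con (+ 2) :* n :+ con 1ℤ :- i)
           ≡.refl (+ n) (+ i) ⟩
    + 2 ℤ.* + n +ℤ 1ℤ ℤ.- + i
      ≡⟨ ≡.cong (λ k → k +ℤ 1ℤ ℤ.- + i) (ℤ.pos-* 2 n) ⟨
    + (2 *ℕ n +ℕ 1) ℤ.- + i
      ≡⟨ ≡.cong (λ k → + k ℤ.- + i) i+j≡2n+1 ⟨
    + i +ℤ + j ℤ.- + i
      ≡⟨ solve 2 (λ i j → i :+ j :- i := j) ≡.refl (+ i) (+ j) ⟩
    + j ∎)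

open import Algebra.Solver.Ring.NaturalCoefficients.Default
  (CommutativeRing.commutativeSemiring ℂ-commutativeRing)
  using (solve; con; _:+_; _:*_; _:=_)
open SetoidReasoning setoid

-- q-Pochhammer factors and finite sums

1--x*y≈1+x*y : ∀ x y → 1ℂ - (- x) * y ≈ 1ℂ + x * y
1--x*y≈1+x*y x y = +-congˡ (trans (-‿cong (sym (-‿distribˡ-* x y))) (-‿involutive (x * y)))

-- With x and y powers of `q`, this distributes the new factor of a q-factorial over the two terms
-- of the Pascal rule.
1-x*y-split : ∀ x y → 1ℂ - x * y ≈ x * (1ℂ - y) + (1ℂ - x)
1-x*y-split x y = sym (begin
  x * (1ℂ - y) + (1ℂ - x)        ≈⟨ solve 3 (λ x m n → x :* (con 1 :+ m) :+ (con 1 :+ n)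
                                      := con 1 :+ x :* m :+ (x :+ n)) refl x (- y) (- x) ⟩
  1ℂ + x * (- y) + (x - x)       ≈⟨ +-cong (+-congˡ (sym (-‿distribʳ-* x y))) (-‿inverseʳ x) ⟩
  1ℂ - x * y + 0ℂ                ≈⟨ +-identityʳ _ ⟩
  1ℂ - x * y                     ∎)

⟨⨾⟩-cong : ∀ {a b} q n → a ≈ b → ⟨ a ⨾ q ⟩ n ≈ ⟨ b ⨾ q ⟩ n
⟨⨾⟩-cong q zero    a≈b = refl
⟨⨾⟩-cong q (suc n) a≈b = *-cong (⟨⨾⟩-cong q n a≈b) (+-congˡ (-‿cong (*-congʳ a≈b)))

-- The definition splits off the last factor; an induction that replaces `a` by `a * q` has to split
-- off the first.
⟨⨾⟩-suc : ∀ a q n → ⟨ a ⨾ q ⟩ suc n ≈ (1ℂ - a) * (⟨ a * q ⨾ q ⟩ n)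
⟨⨾⟩-suc a q zero    = trans (*-comm _ _) (*-congʳ (+-congˡ (-‿cong (*-identityʳ a))))
⟨⨾⟩-suc a q (suc n) = begin
  ⟨ a ⨾ q ⟩ suc n * (1ℂ - a * q ^ suc n)
    ≈⟨ *-cong (⟨⨾⟩-suc a q n) (+-congˡ (-‿cong (sym (*-assoc a q (q ^ n))))) ⟩
  (1ℂ - a) * (⟨ a * q ⨾ q ⟩ n) * (1ℂ - a * q * q ^ n)
    ≈⟨ *-assoc _ _ _ ⟩
  (1ℂ - a) * (⟨ a * q ⨾ q ⟩ suc n) ∎

sum-last : ∀ n (f : ℕ → ℂ) →
  ∑[ i < suc n ] f (toℕ i) ≈ ∑[ i < n ] f (toℕ i) + f n
sum-last zero    f = trans (+-identityʳ (f 0)) (sym (+-identityˡ (f 0)))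
sum-last (suc n) f = trans (+-congˡ (sum-last n (λ i → f (suc i))))
  (sym (+-assoc _ _ _))

-- Gaussian binomial coefficients and sums weighted by them

module _ (q : ℂ) where

  -- Defined by the Pascal rule rather than as a quotient of q-factorials, so no division is
  -- involved.
  qbinomial : ℕ → ℕ → ℂ
  qbinomial n       zero    = 1ℂ
  qbinomial zero    (suc i) = 0ℂ
  qbinomial (suc n) (suc i) = q ^ suc i * qbinomial n (suc i) + qbinomial n i

  qbinomial-zero : ∀ n {i} → n ℕ.< i → qbinomial n i ≈ 0ℂ
  qbinomial-zero zero    {suc i} _            = refl
  qbinomial-zero (suc n) {suc i} (ℕ.s≤s n<i) = begin
    q ^ suc i * qbinomial n (suc i) + qbinomial n i
      ≈⟨ +-cong (*-congˡ (qbinomial-zero n (ℕ.m<n⇒m<1+n n<i))) (qbinomial-zero n n<i) ⟩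
    q ^ suc i * 0ℂ + 0ℂ
      ≈⟨ trans (+-identityʳ _) (zeroʳ _) ⟩
    0ℂ ∎

  qbinomial-diagonal : ∀ n → qbinomial n n ≈ 1ℂ
  qbinomial-diagonal zero    = refl
  qbinomial-diagonal (suc n) = trans
    (+-cong (trans (*-congˡ (qbinomial-zero n (ℕ.n<1+n n))) (zeroʳ _)) (qbinomial-diagonal n))
    (+-identityˡ 1ℂ)

  -- The quotient formula with denominators cleared. The Pascal rule reduces it to (i + 1, j) and
  -- (i, j + 1), which share the same right-hand side, and `1-x*y-split` recombines the two
  -- cofactors. The order of the factors is that of the Bailey denominators.
  qbinomial-⟨⨾⟩ : ∀ i j →
    qbinomial (i +ℕ j) i * ((⟨ q ⨾ q ⟩ j) * (⟨ q ⨾ q ⟩ i)) ≈ ⟨ q ⨾ q ⟩ (i +ℕ j)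
  qbinomial-⟨⨾⟩ zero    j = trans (*-identityˡ _) (*-identityʳ _)
  qbinomial-⟨⨾⟩ (suc i) zero = begin
    qbinomial (suc i +ℕ 0) (suc i) * (1ℂ * (⟨ q ⨾ q ⟩ suc i))
      ≈⟨ *-cong (reflexive (≡.cong (λ n → qbinomial n (suc i)) (ℕ.+-identityʳ (suc i)))) (*-identityˡ _) ⟩
    qbinomial (suc i) (suc i) * (⟨ q ⨾ q ⟩ suc i)
      ≈⟨ trans (*-congʳ (qbinomial-diagonal (suc i))) (*-identityˡ _) ⟩
    ⟨ q ⨾ q ⟩ suc i
      ≈⟨ reflexive (≡.cong (⟨ q ⨾ q ⟩_) (≡.sym (ℕ.+-identityʳ (suc i)))) ⟩
    ⟨ q ⨾ q ⟩ (suc i +ℕ 0) ∎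
  qbinomial-⟨⨾⟩ (suc i) (suc j) = begin
    (q ^ suc i * qbinomial n (suc i) + qbinomial n i) * ((J * v) * (I * u))
      ≈⟨ solve 7 (λ p b c J v I u → (p :* b :+ c) :* ((J :* v) :* (I :* u))
           := p :* v :* (b :* (J :* (I :* u))) :+ u :* (c :* ((J :* v) :* I)))
           refl (q ^ suc i) (qbinomial n (suc i)) (qbinomial n i) J v I u ⟩
    q ^ suc i * v * (qbinomial n (suc i) * (J * (I * u)))
      + u * (qbinomial n i * ((J * v) * I))
      ≈⟨ +-cong (*-congˡ (trans
           (reflexive (≡.cong (λ m → qbinomial m (suc i) * (J * (I * u))) (ℕ.+-suc i j)))
           (trans (qbinomial-⟨⨾⟩ (suc i) j)
             (reflexive (≡.cong (⟨ q ⨾ q ⟩_) (≡.sym (ℕ.+-suc i j)))))))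
         (*-congˡ (qbinomial-⟨⨾⟩ i (suc j))) ⟩
    q ^ suc i * v * (⟨ q ⨾ q ⟩ n) + u * (⟨ q ⨾ q ⟩ n)
      ≈⟨ solve 4 (λ p v u x → p :* v :* x :+ u :* x := x :* (p :* v :+ u))
           refl (q ^ suc i) v u (⟨ q ⨾ q ⟩ n) ⟩
    (⟨ q ⨾ q ⟩ n) * (q ^ suc i * v + u)
      ≈⟨ *-congˡ (sym (1-x*y-split (q ^ suc i) (q ^ suc j))) ⟩
    (⟨ q ⨾ q ⟩ n) * (1ℂ - q ^ suc i * q ^ suc j)
      ≈⟨ *-congˡ (+-congˡ (-‿cong (sym (^-homo-* q (suc i) (suc j))))) ⟩
    ⟨ q ⨾ q ⟩ suc n ∎
    where
    n = i +ℕ suc j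
    I = ⟨ q ⨾ q ⟩ i
    J = ⟨ q ⨾ q ⟩ j
    u = 1ℂ - q ^ suc i
    v = 1ℂ - q ^ suc j

  qbinomialSum : ℕ → (ℕ → ℂ) → ℂ
  qbinomialSum n f = ∑[ i < suc n ] (qbinomial n (toℕ i) * f (toℕ i))

  qbinomialSum-cong : ∀ n {f g : ℕ → ℂ} → (∀ i → f i ≈ g i) → qbinomialSum n f ≈ qbinomialSum n g
  qbinomialSum-cong n f≈g = sum-cong-≋ {suc n} (λ i → *-congˡ {qbinomial n (toℕ i)} (f≈g (toℕ i)))

  qbinomialSum-* : ∀ n c f → qbinomialSum n (λ i → c * f i) ≈ c * qbinomialSum n f
  qbinomialSum-* n c f = trans
    (sum-cong-≋ {suc n} (λ i → solve 3 (λ b c x → b :* (c :* x) := c :* (b :* x))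
      refl (qbinomial n (toℕ i)) c (f (toℕ i))))
    (sym (*-distribˡ-sum {suc n} c (λ i → qbinomial n (toℕ i) * f (toℕ i))))

  -- The Pascal rule transposed onto `f`. Its first term gives the summands `g i` with i from 1 to n
  -- + 1; the index 0 is supplied by the first summand of row n + 1, and the index n + 1 drops out
  -- because its coefficient in row n is zero.
  qbinomialSum-suc : ∀ n f →
    qbinomialSum (suc n) f ≈ qbinomialSum n (λ i → q ^ i * f i) + qbinomialSum n (λ i → f (suc i))
  qbinomialSum-suc n f = begin
    h 0 + ∑[ i < suc n ] (qbinomial (suc n) (suc (toℕ i)) * f (suc (toℕ i)))
      -- `h 0` and `g 0` agree because both coefficients and `q ^ 0` are 1.
      ≈⟨ +-cong (*-congˡ (sym (*-identityˡ (f 0)))) (trans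
           (sum-cong-≋ {suc n} (λ i → solve 4 (λ p b c x → (p :* b :+ c) :* x := b :* (p :* x) :+ c :* x)
             refl (q ^ suc (toℕ i)) (qbinomial n (suc (toℕ i))) (qbinomial n (toℕ i))
               (f (suc (toℕ i)))))
           (∑-distrib-+ {suc n} (λ i → g (suc (toℕ i))) (λ i → qbinomial n (toℕ i) * f (suc (toℕ i))))) ⟩
    g 0 + (∑[ i < suc n ] g (suc (toℕ i)) + qbinomialSum n (λ i → f (suc i)))
      ≈⟨ sym (+-assoc _ _ _) ⟩
    ∑[ i < suc (suc n) ] g (toℕ i) + qbinomialSum n (λ i → f (suc i))
      ≈⟨ +-congʳ (trans (sum-last (suc n) g) (trans (+-congˡ g-last) (+-identityʳ _))) ⟩
    qbinomialSum n (λ i → q ^ i * f i) + qbinomialSum n (λ i → f (suc i)) ∎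
    where
    g h : ℕ → ℂ
    g i = qbinomial n i * (q ^ i * f i)
    h i = qbinomial (suc n) i * f i
    g-last : g (suc n) ≈ 0ℂ
    g-last = trans (*-congʳ (qbinomial-zero n (ℕ.n<1+n n))) (zeroˡ _)

-- Rothe's identity
qbinomialSum-⟨⨾⟩ : ∀ q x n →
  qbinomialSum q n (λ i → x ^ i * q ^ choose₂ (+ i)) ≈ ⟨ - x ⨾ q ⟩ n
qbinomialSum-⟨⨾⟩ q x zero    = trans (+-identityʳ _) (trans (*-identityˡ _) (*-identityˡ _))
qbinomialSum-⟨⨾⟩ q x (suc n) = begin
  qbinomialSum q (suc n) f
    ≈⟨ qbinomialSum-suc q n f ⟩
  qbinomialSum q n (λ i → q ^ i * f i) + qbinomialSum q n (λ i → f (suc i))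
    -- Both halves are the sum for `x * q`, the second one multiplied by `x`; this produces 1 + x,
    -- the first factor of the product sought.
    ≈⟨ +-cong (qbinomialSum-cong q n head) (qbinomialSum-cong q n tail) ⟩
  qbinomialSum q n g + qbinomialSum q n (λ i → x * g i)
    ≈⟨ +-congˡ (qbinomialSum-* q n x g) ⟩
  qbinomialSum q n g + x * qbinomialSum q n g
    ≈⟨ solve 2 (λ x s → s :+ x :* s := (con 1 :+ x) :* s) refl x (qbinomialSum q n g) ⟩
  (1ℂ + x) * qbinomialSum q n g
    ≈⟨ *-cong (+-congˡ (sym (-‿involutive x))) (qbinomialSum-⟨⨾⟩ q (x * q) n) ⟩
  (1ℂ - (- x)) * (⟨ - (x * q) ⨾ q ⟩ n)
    ≈⟨ *-congˡ (⟨⨾⟩-cong q n (-‿distribˡ-* x q)) ⟩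
  (1ℂ - (- x)) * (⟨ (- x) * q ⨾ q ⟩ n)
    ≈⟨ ⟨⨾⟩-suc (- x) q n ⟨
  ⟨ - x ⨾ q ⟩ suc n ∎
  where
  f g : ℕ → ℂ
  f i = x ^ i * q ^ choose₂ (+ i)
  g i = (x * q) ^ i * q ^ choose₂ (+ i)
  head : ∀ i → q ^ i * f i ≈ g i
  head i = trans
    (solve 3 (λ Q X C → Q :* (X :* C) := X :* Q :* C) refl (q ^ i) (x ^ i) (q ^ choose₂ (+ i)))
    (*-congʳ (sym (^-distrib-* x q i)))
  tail : ∀ i → f (suc i) ≈ x * g i
  tail i = begin
    x * x ^ i * q ^ choose₂ (+ suc i)
      ≈⟨ *-congˡ (trans (^-congʳ q (choose₂-pos i)) (^-homo-* q i (choose₂ (+ i)))) ⟩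
    x * x ^ i * (q ^ i * q ^ choose₂ (+ i))
      ≈⟨ solve 4 (λ x Q X C → x :* X :* (Q :* C) := x :* (Q :* (X :* C)))
           refl x (q ^ i) (x ^ i) (q ^ choose₂ (+ i)) ⟩
    x * (q ^ i * f i)
      ≈⟨ *-congˡ (head i) ⟩
    x * g i ∎

-- The finite Jacobi triple product

module _ (q z : ℂ) (z≠0 : z ≠0) where

  ^[]-suc : ∀ k → z ^ (k +ℤ 1ℤ) [ z≠0 ] ≈ z * z ^ k [ z≠0 ]
  ^[]-suc (+ n)           = ^-congʳ z (ℕ.+-comm n 1)
  ^[]-suc -[1+ zero ]     = sym (trans (*-congˡ (*-identityʳ _)) (inv-inverseʳ z z≠0))
  ^[]-suc -[1+ suc n ]    = begin
    inv z z≠0 ^ suc n                      ≈⟨ *-identityˡ _ ⟨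
    1ℂ * inv z z≠0 ^ suc n                 ≈⟨ *-congʳ (inv-inverseʳ z z≠0) ⟨
    z * inv z z≠0 * inv z z≠0 ^ suc n      ≈⟨ *-assoc _ _ _ ⟩
    z * inv z z≠0 ^ suc (suc n)            ∎

  α : ℤ → ℂ
  α k = z ^ k [ z≠0 ] * q ^ choose₂ (k +ℤ 1ℤ)

  -- Lowering the exponent of z by one costs a factor 1/z, and `choose₂-⊖` balances the exponents of
  -- q while keeping them natural numbers.
  α-shift : ∀ i m → q ^ i * α (i ⊖ suc m) ≈ inv z z≠0 * q ^ m * α (i ⊖ m)
  α-shift i m = begin
    q ^ i * (Z * q ^ choose₂ (k +ℤ 1ℤ))
      ≈⟨ *-congˡ (*-congˡ (^-congʳ q (≡.cong choose₂ (⊖-suc i m)))) ⟩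
    q ^ i * (Z * q ^ choose₂ (i ⊖ m))
      ≈⟨ solve 3 (λ Q Z C → Q :* (Z :* C) := Z :* (Q :* C)) refl (q ^ i) Z (q ^ choose₂ (i ⊖ m)) ⟩
    Z * (q ^ i * q ^ choose₂ (i ⊖ m))
      ≈⟨ *-cong Z≈ exponents ⟩
    inv z z≠0 * Z′ * (q ^ m * q ^ choose₂ (i ⊖ m +ℤ 1ℤ))
      ≈⟨ solve 4 (λ w Z Q C → w :* Z :* (Q :* C) := w :* Q :* (Z :* C)) refl
           (inv z z≠0) Z′ (q ^ m) (q ^ choose₂ (i ⊖ m +ℤ 1ℤ)) ⟩
    inv z z≠0 * q ^ m * α (i ⊖ m) ∎
    where
    k = i ⊖ suc m
    Z = z ^ k [ z≠0 ]
    Z′ = z ^ (i ⊖ m) [ z≠0 ]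
    Z≈ : Z ≈ inv z z≠0 * Z′
    Z≈ = begin
      Z                                   ≈⟨ *-identityˡ Z ⟨
      1ℂ * Z                              ≈⟨ *-congʳ (inv-inverseʳ z z≠0) ⟨
      z * inv z z≠0 * Z                   ≈⟨ *-congʳ (*-comm z (inv z z≠0)) ⟩
      inv z z≠0 * z * Z                   ≈⟨ *-assoc _ _ _ ⟩
      inv z z≠0 * (z * Z)                 ≈⟨ *-congˡ (^[]-suc k) ⟨
      inv z z≠0 * z ^ (k +ℤ 1ℤ) [ z≠0 ]   ≈⟨ *-congˡ (reflexive (≡.cong (λ k → z ^ k [ z≠0 ]) (⊖-suc i m))) ⟩
      inv z z≠0 * Z′                      ∎
    exponents : q ^ i * q ^ choose₂ (i ⊖ m) ≈ q ^ m * q ^ choose₂ (i ⊖ m +ℤ 1ℤ)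
    exponents = begin
      q ^ i * q ^ choose₂ (i ⊖ m)           ≈⟨ ^-homo-* q i (choose₂ (i ⊖ m)) ⟨
      q ^ (i +ℕ choose₂ (i ⊖ m))            ≈⟨ ^-congʳ q (choose₂-⊖ i m) ⟩
      q ^ (m +ℕ choose₂ (i ⊖ m +ℤ 1ℤ))      ≈⟨ ^-homo-* q m (choose₂ (i ⊖ m +ℤ 1ℤ)) ⟩
      q ^ m * q ^ choose₂ (i ⊖ m +ℤ 1ℤ)     ∎

  -- Induction on `m`: of the two halves given by the Pascal rule, `α-shift` turns the first into a
  -- multiple of the sum for `m`, and the second is that sum itself, since `suc i ⊖ suc m` is
  -- `i ⊖ m`.
  qbinomialSum-α : ∀ m n → qbinomialSum q (m +ℕ n) (λ i → α (i ⊖ m))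
    ≈ (⟨ (- 1ℂ) / z [ z≠0 ] ⨾ q ⟩ m) * (⟨ - (z * q) ⨾ q ⟩ n)
  qbinomialSum-α zero    n = begin
    qbinomialSum q n (λ i → α (i ⊖ 0))
      ≈⟨ qbinomialSum-cong q n term ⟩
    qbinomialSum q n (λ i → (z * q) ^ i * q ^ choose₂ (+ i))
      ≈⟨ qbinomialSum-⟨⨾⟩ q (z * q) n ⟩
    ⟨ - (z * q) ⨾ q ⟩ n
      ≈⟨ *-identityˡ _ ⟨
    1ℂ * (⟨ - (z * q) ⨾ q ⟩ n) ∎
    where
    -- The exponent of q exceeds `choose₂ (+ i)` by `i`, and this `q ^ i` merges with `z ^ i`, so
    -- Rothe's identity applies at `z * q`.
    term : ∀ i → z ^ i * q ^ choose₂ (+ (i +ℕ 1)) ≈ (z * q) ^ i * q ^ choose₂ (+ i)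
    term i = begin
      z ^ i * q ^ choose₂ (+ (i +ℕ 1))
        ≈⟨ *-congˡ (^-congʳ q (choose₂-⊖ i 0)) ⟨
      z ^ i * q ^ (i +ℕ choose₂ (+ i))
        ≈⟨ *-congˡ (^-homo-* q i (choose₂ (+ i))) ⟩
      z ^ i * (q ^ i * q ^ choose₂ (+ i))
        ≈⟨ *-assoc _ _ _ ⟨
      z ^ i * q ^ i * q ^ choose₂ (+ i)
        ≈⟨ *-congʳ (^-distrib-* z q i) ⟨
      (z * q) ^ i * q ^ choose₂ (+ i) ∎
  qbinomialSum-α (suc m) n = begin
    qbinomialSum q (suc m +ℕ n) (λ i → α (i ⊖ suc m))
      ≈⟨ qbinomialSum-suc q (m +ℕ n) (λ i → α (i ⊖ suc m)) ⟩
    qbinomialSum q (m +ℕ n) (λ i → q ^ i * α (i ⊖ suc m))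
      + qbinomialSum q (m +ℕ n) (λ i → α (suc i ⊖ suc m))
      ≈⟨ +-cong (qbinomialSum-cong q (m +ℕ n) (λ i → α-shift i m))
           (qbinomialSum-cong q (m +ℕ n) (λ i → reflexive (≡.cong α (ℤ.[1+m]⊖[1+n]≡m⊖n i m)))) ⟩
    qbinomialSum q (m +ℕ n) (λ i → w * q ^ m * α (i ⊖ m)) + S
      ≈⟨ +-congʳ (qbinomialSum-* q (m +ℕ n) (w * q ^ m) (λ i → α (i ⊖ m))) ⟩
    w * q ^ m * S + S
      ≈⟨ solve 2 (λ c s → c :* s :+ s := s :* (con 1 :+ c)) refl (w * q ^ m) S ⟩
    S * (1ℂ + w * q ^ m)
      ≈⟨ *-cong (qbinomialSum-α m n) (sym factor) ⟩
    (⟨ (- 1ℂ) / z [ z≠0 ] ⨾ q ⟩ m) * (⟨ - (z * q) ⨾ q ⟩ n) * (1ℂ - (- 1ℂ) * w * q ^ m)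
      ≈⟨ solve 3 (λ a b c → a :* b :* c := a :* c :* b) refl
           (⟨ (- 1ℂ) / z [ z≠0 ] ⨾ q ⟩ m) (⟨ - (z * q) ⨾ q ⟩ n) (1ℂ - (- 1ℂ) * w * q ^ m) ⟩
    (⟨ (- 1ℂ) / z [ z≠0 ] ⨾ q ⟩ suc m) * (⟨ - (z * q) ⨾ q ⟩ n) ∎
    where
    w = inv z z≠0
    S = qbinomialSum q (m +ℕ n) (λ i → α (i ⊖ m))
    factor : 1ℂ - (- 1ℂ) * w * q ^ m ≈ 1ℂ + w * q ^ m
    factor = begin
      1ℂ - (- 1ℂ) * w * q ^ m     ≈⟨ +-congˡ (-‿cong (*-assoc (- 1ℂ) w (q ^ m))) ⟩
      1ℂ - (- 1ℂ) * (w * q ^ m)   ≈⟨ 1--x*y≈1+x*y 1ℂ (w * q ^ m) ⟩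
      1ℂ + 1ℂ * (w * q ^ m)       ≈⟨ +-congˡ (*-identityˡ _) ⟩
      1ℂ + w * q ^ m              ∎

-- From the triple product to the Bailey pair

-- Expanding by `e` times its inverse exposes `c * e`, which cancels against the inverse of `d`. In
-- the application `c` is a q-binomial coefficient and `d` is the common denominator.
/-cancelˡ : ∀ {x c y} {d e : ℂ} (d≠0 : d ≠0) (e≠0 : e ≠0) → c * e ≈ d →
  x * c ≈ y → y / d [ d≠0 ] ≈ x / e [ e≠0 ]
/-cancelˡ {x} {c} {y} {d} {e} d≠0 e≠0 ce≈d xc≈y = begin
  y * inv d d≠0
    ≈⟨ *-congʳ (sym xc≈y) ⟩
  x * c * inv d d≠0
    ≈⟨ trans (sym (*-identityʳ _)) (*-congˡ (sym (inv-inverseʳ e e≠0))) ⟩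
  x * c * inv d d≠0 * (e * inv e e≠0)
    ≈⟨ solve 5 (λ x c d′ e e′ → x :* c :* d′ :* (e :* e′) := x :* e′ :* (c :* e :* d′)) refl
         x c (inv d d≠0) e (inv e e≠0) ⟩
  x * inv e e≠0 * (c * e * inv d d≠0)
    ≈⟨ *-congˡ (trans (*-congʳ ce≈d) (inv-inverseʳ d d≠0)) ⟩
  x * inv e e≠0 * 1ℂ
    ≈⟨ *-identityʳ _ ⟩
  x / e [ e≠0 ] ∎

-- Rewriting the length of the range to `+ n` lets its truncation at 0 and its absolute value
-- compute away.
sumFromTo-count : ∀ a b (f : ℤ → ℂ) {n} → b ℤ.- a +ℤ 1ℤ ≡ + n →
  ∑[ k from a to b ] f k ≈ ∑[ i < n ] f (a +ℤ + toℕ i)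
sumFromTo-count a b f eq rewrite eq = refl

-- D≠0 and E≠0 are arbitrary because comparing the unfolded ⟨q⨾q⟩≠0 is infeasible.
∑-α/⟨⨾⟩ : ∀ q z (z≠0 : z ≠0) n (D≠0 : (⟨ q ⨾ q ⟩ (2 *ℕ n +ℕ 1)) ≠0)
  (E≠0 : ∀ k → (⟨ q ⨾ q ⟩ ℤ.∣ + n ℤ.- k ∣ * ⟨ q ⨾ q ⟩ ℤ.∣ + n +ℤ k +ℤ 1ℤ ∣) ≠0) →
  (⟨ (- 1ℂ) / z [ z≠0 ] ⨾ q ⟩ (n +ℕ 1)) * (⟨ - (z * q) ⨾ q ⟩ n)
    / ⟨ q ⨾ q ⟩ (2 *ℕ n +ℕ 1) [ D≠0 ]
  ≈ ∑[ k from ℤ.- (+ n) ℤ.- 1ℤ to + n ]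
      (α q z z≠0 k / (⟨ q ⨾ q ⟩ ℤ.∣ + n ℤ.- k ∣ * ⟨ q ⨾ q ⟩ ℤ.∣ + n +ℤ k +ℤ 1ℤ ∣) [ E≠0 k ])
∑-α/⟨⨾⟩ q z z≠0 n D≠0 E≠0 = sym (begin
  ∑[ k from a to + n ] F k
    ≈⟨ sumFromTo-count a (+ n) F (n-a+1≡2n+2 n) ⟩
  ∑[ i < suc N ] F (a +ℤ + toℕ i)
    -- An index below `suc N` is at most `N`, so the truncated difference is its true complement.
    ≈⟨ sum-cong-≋ {suc N} (λ i → term (toℕ i) (N ℕ.∸ toℕ i) (ℕ.m+[n∸m]≡n (toℕ≤pred[n] i))) ⟩
  ∑[ i < suc N ] (qbinomial q N (toℕ i) * α q z z≠0 (toℕ i ⊖ suc n) * inv D D≠0)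
    ≈⟨ *-distribʳ-sum {suc N} (inv D D≠0)
         (λ i → qbinomial q N (toℕ i) * α q z z≠0 (toℕ i ⊖ suc n)) ⟨
  qbinomialSum q N (λ i → α q z z≠0 (i ⊖ suc n)) * inv D D≠0
    ≈⟨ *-congʳ numerator ⟩
  (⟨ (- 1ℂ) / z [ z≠0 ] ⨾ q ⟩ (n +ℕ 1)) * (⟨ - (z * q) ⨾ q ⟩ n) * inv D D≠0 ∎)
  where
  N = 2 *ℕ n +ℕ 1
  a = ℤ.- (+ n) ℤ.- 1ℤ
  D = ⟨ q ⨾ q ⟩ N
  E F : ℤ → ℂ
  E k = ⟨ q ⨾ q ⟩ ℤ.∣ + n ℤ.- k ∣ * ⟨ q ⨾ q ⟩ ℤ.∣ + n +ℤ k +ℤ 1ℤ ∣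
  F k = α q z z≠0 k / E k [ E≠0 k ]

  term : ∀ i j → i +ℕ j ≡ N →
    F (a +ℤ + i) ≈ qbinomial q N i * α q z z≠0 (i ⊖ suc n) * inv D D≠0
  term i j eq = sym (/-cancelˡ D≠0 (E≠0 (a +ℤ + i))
    (begin
      qbinomial q N i * E (a +ℤ + i)
        ≈⟨ *-cong (reflexive (≡.cong (λ m → qbinomial q m i) (≡.sym eq)))
             (reflexive (≡.cong₂ (λ x y → ⟨ q ⨾ q ⟩ x * ⟨ q ⨾ q ⟩ y)
               (∣n-[a+i]∣≡j n i eq) (∣n+[a+i]+1∣≡i n i))) ⟩
      qbinomial q (i +ℕ j) i * (⟨ q ⨾ q ⟩ j * ⟨ q ⨾ q ⟩ i)
        ≈⟨ qbinomial-⟨⨾⟩ q i j ⟩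
      ⟨ q ⨾ q ⟩ (i +ℕ j)
        ≈⟨ reflexive (≡.cong (⟨ q ⨾ q ⟩_) eq) ⟩
      D ∎)
    (trans (*-comm _ _)
      (*-congˡ (reflexive (≡.cong (α q z z≠0) (a+i≡i⊖[1+n] n i))))))

  numerator : qbinomialSum q N (λ i → α q z z≠0 (i ⊖ suc n))
    ≈ (⟨ (- 1ℂ) / z [ z≠0 ] ⨾ q ⟩ (n +ℕ 1)) * (⟨ - (z * q) ⨾ q ⟩ n)
  numerator = begin
    qbinomialSum q N (λ i → α q z z≠0 (i ⊖ suc n))
      -- The row 2n + 1 is split as (n + 1) + n, matching the lengths of the two products.
      ≈⟨ reflexive (≡.cong (λ m → qbinomialSum q m (λ i → α q z z≠0 (i ⊖ suc n))) N≡) ⟩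
    qbinomialSum q (suc n +ℕ n) (λ i → α q z z≠0 (i ⊖ suc n))
      ≈⟨ qbinomialSum-α q z z≠0 (suc n) n ⟩
    (⟨ (- 1ℂ) / z [ z≠0 ] ⨾ q ⟩ suc n) * (⟨ - (z * q) ⨾ q ⟩ n)
      ≈⟨ *-congʳ (reflexive (≡.cong (⟨ (- 1ℂ) / z [ z≠0 ] ⨾ q ⟩_) (ℕ.+-comm 1 n))) ⟩
    (⟨ (- 1ℂ) / z [ z≠0 ] ⨾ q ⟩ (n +ℕ 1)) * (⟨ - (z * q) ⨾ q ⟩ n) ∎
    where
    N≡ : N ≡ suc n +ℕ n
    N≡ = ≡.trans (ℕ.+-comm (2 *ℕ n) 1) (≡.cong (λ j → suc (n +ℕ j)) (ℕ.+-identityʳ n))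

lemma3p1 : (q z : ℂ) (∣q∣<1 : ∣ q ∣ <ℝ 1ℝ) (z≠0 : z ≠0) →
    IsAsymmetricBilateralBaileyPair q ∣q∣<1
    (λ n → z ^ n [ z≠0 ] * q ^ choose₂ (n +ℤ 1ℤ))
    (λ n → (⟨ (- 1ℂ) / z [ z≠0 ] ⨾ q ⟩ (n +ℕ 1)) * (⟨ - (z * q) ⨾ q ⟩ n)
    / ⟨ q ⨾ q ⟩ (2 *ℕ n +ℕ 1) [ ⟨q⨾q⟩≠0 ∣q∣<1 (2 *ℕ n +ℕ 1) ])
lemma3p1 q z ∣q∣<1 z≠0 n = ∑-α/⟨⨾⟩ q z z≠0 n (⟨q⨾q⟩≠0 ∣q∣<1 (2 *ℕ n +ℕ 1))
  (λ k → Complex.*-≠0 (⟨q⨾q⟩≠0 ∣q∣<1 ℤ.∣ + n ℤ.- k ∣) (⟨q⨾q⟩≠0 ∣q∣<1 ℤ.∣ + n +ℤ k +ℤ 1ℤ ∣))
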